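{- There is a polynomial-time algorithm that, given an instance $\Pi=\{\pi_j\}_{j\in\mathbb Z_k}$ of Ulam median consisting of $k$ permutations over an alphabet $\Sigma$ of size $d$, constructs an instance $\mathcal C(\Pi)=\{\sigma_j\}_{j\in\mathbb Z_k}$ of Ulam center consisting of $k$ permutations over an alphabet $\Sigma'$ of size $kd$ such that $$\mathrm{OPT}_{\mathrm{ctr}}(\mathcal C(\Pi))=\mathrm{OPT}_{\mathrm{med}}(\Pi).$$ Moreover, from any center solution for $\mathcal C(\Pi)$ of radius at most $R$ (that is, any $\tau\in\mathcal P(\Sigma')$ with $\mathrm{rad}_{\mathcal C(\Pi)}(\tau)\le R$), one can compute in polynomial time a permutation $\rho\in\mathcal P(\Sigma)$ with $\mathrm{cost}_\Pi(\rho)\le R$.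
   Context: $\mathbb Z_k=\{0,1,\ldots,k-1\}$ is used as an index set. For a finite alphabet $\Sigma$, a permutation of $\Sigma$ is a string containing each symbol exactly once; $\mathcal P(\Sigma)$ is the set of these. $\mathrm{LCS}(x,y)$ is the length of a longest common subsequence, and $\mathcal U(x,y):=|\Sigma|-\mathrm{LCS}(x,y)$ for $x,y\in\mathcal P(\Sigma)$. For a multiset $\Pi$ of permutations of $\Sigma$ and $\sigma\in\mathcal P(\Sigma)$: $\mathrm{cost}_\Pi(\sigma)=\sum_{\pi\in\Pi}\mathcal U(\sigma,\pi)$, $\mathrm{OPT}_{\mathrm{med}}(\Pi)=\min_{\sigma}\mathrm{cost}_\Pi(\sigma)$ (Ulam median), $\mathrm{rad}_\Pi(\sigma)=\max_{\pi\in\Pi}\mathcal U(\sigma,\pi)$, $\mathrm{OPT}_{\mathrm{ctr}}(\Pi)=\min_\sigma\mathrm{rad}_\Pi(\sigma)$ (Ulam center). -}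

module Defs where

open import Data.Nat.Base using (ℕ; zero; suc; _+_; _*_; _∸_; _^_; _≤_; z≤n; s≤s; NonZero)
open import Data.Nat.Properties as ℕₚ using (≤-refl; ≤-trans; ≤-reflexive; m≤n⇒m≤1+n)
open import Data.Nat.ListAction using (sum)
open import Data.Fin.Base using (Fin; toℕ)
open import Data.Fin.Properties using (_≟_; all?; injective⇒≤)
open import Data.List.Base
  using (List; []; _∷_; map; length; tabulate; allFin; lookup; cartesianProductWith)
open import Data.List.Extrema.Nat using (max)
open import Data.List.Membership.Propositional using (_∈_)
open import Data.List.Membership.Propositional.Properties
  using (∈-allFin; ∈-lookup; ∈-cartesianProductWith⁺)
open import Data.List.Relation.Binary.Sublist.Propositional using (_⊆_; []; _∷_; _∷ʳ_; minimum)
open import Data.List.Relation.Binary.Sublist.Propositional.Properties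
  using (∷ʳ⁻; ∷⁻)
open import Data.List.Relation.Unary.All as All using ([]; _∷_)
open import Data.List.Relation.Unary.AllPairs using ([]; _∷_)
open import Data.List.Relation.Unary.Any using (here; there)
open import Data.List.Relation.Unary.Unique.Propositional using (Unique)
open import Data.List.Relation.Unary.Unique.Propositional.Properties using (allFin⁺)
open import Data.Product.Base using (Σ; ∃; ∃-syntax; _×_; _,_; proj₁; proj₂)
open import Data.Sum.Base using (inj₁; inj₂)
open import Relation.Binary.PropositionalEquality using (_≡_; refl; sym; cong; subst)
open import Relation.Nullary using (Dec; yes; no; _×-dec_; contradiction)

------------------------------------------------------------------------
-- Longest common subsequences

-- Subsequences need not be contiguous: _⊆_ is the order-preserving
-- embedding relation on lists.
IsLCS : ∀ {n} → List (Fin n) → List (Fin n) → ℕ → Set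
IsLCS x y l =
  (∃[ z ] z ⊆ x × z ⊆ y × length z ≡ l) ×
  (∀ z → z ⊆ x → z ⊆ y → length z ≤ l)

private

  lcs-step : ∀ {n} (a b : Fin n) {x y : List (Fin n)} → ∃[ l ] IsLCS x y l →
             ∃[ l ] IsLCS x (b ∷ y) l → ∃[ l ] IsLCS (a ∷ x) y l →
             ∃[ l ] IsLCS (a ∷ x) (b ∷ y) l
  lcs-step a b {x} {y} (l , (z , p , q , e) , longest)
    (l₁ , (z₁ , p₁ , q₁ , e₁) , longest₁) (l₂ , (z₂ , p₂ , q₂ , e₂) , longest₂)
    with a ≟ b
  ... | yes refl =
    suc l , (a ∷ z , refl ∷ p , refl ∷ q , cong suc e) ,
    λ { []       _  _  → z≤n
      ; (c ∷ z′) p′ q′ → s≤s (longest z′ (∷⁻ p′) (∷⁻ q′)) }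
  ... | no a≢b with ℕₚ.≤-total l₁ l₂
  ...   | inj₁ l₁≤l₂ = l₂ , (z₂ , p₂ , b ∷ʳ q₂ , e₂) , bound
    where
    bound : ∀ z → z ⊆ a ∷ x → z ⊆ b ∷ y → length z ≤ l₂
    bound z (.a ∷ʳ p)  q          = ≤-trans (longest₁ z p q) l₁≤l₂
    bound z (e ∷ p)    (.b ∷ʳ q)  = longest₂ z (e ∷ p) q
    bound _ (refl ∷ p) (refl ∷ q) = contradiction refl a≢b
  ...   | inj₂ l₂≤l₁ = l₁ , (z₁ , a ∷ʳ p₁ , q₁ , e₁) , bound
    where
    bound : ∀ z → z ⊆ a ∷ x → z ⊆ b ∷ y → length z ≤ l₁
    bound z (.a ∷ʳ p)  q          = longest₁ z p q
    bound z (e ∷ p)    (.b ∷ʳ q)  = ≤-trans (longest₂ z (e ∷ p) q) l₂≤l₁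
    bound _ (refl ∷ p) (refl ∷ q) = contradiction refl a≢b

lcs : ∀ {n} (x y : List (Fin n)) → ∃[ l ] IsLCS x y l
lcs []      y  = 0 , ([] , [] , minimum y , refl) , λ { .[] [] _ → z≤n }
lcs (a ∷ x) [] = 0 , ([] , minimum (a ∷ x) , [] , refl) , λ { .[] _ [] → z≤n }
lcs (a ∷ x) (b ∷ y) = lcs-step a b (lcs x y) (lcs x (b ∷ y)) (lcs (a ∷ x) y)

LCS : ∀ {n} → List (Fin n) → List (Fin n) → ℕ
LCS x y = proj₁ (lcs x y)

LCS-isLCS : ∀ {n} (x y : List (Fin n)) → IsLCS x y (LCS x y)
LCS-isLCS x y = proj₂ (lcs x y)

------------------------------------------------------------------------
-- Permutations of the alphabet Fin n

IsPermutation : ∀ {n} → List (Fin n) → Set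
IsPermutation w = (∀ a → a ∈ w) × Unique w

record 𝒫 (n : ℕ) : Set where
  constructor _,_
  field
    word          : List (Fin n)
    isPermutation : IsPermutation word

open 𝒫 public

-- No truncation occurs in _∸_: a common subsequence of two permutations
-- of Fin n has length at most n.
𝒰 : ∀ {n} → 𝒫 n → 𝒫 n → ℕ
𝒰 {n} x y = n ∸ LCS (word x) (word y)

------------------------------------------------------------------------
-- Minima over all permutations

IsMinimum : {A : Set} → (A → ℕ) → ℕ → Set
IsMinimum f m = (∃[ a ] f a ≡ m) × (∀ a → m ≤ f a)

private

  isPermutation? : ∀ {n} (w : List (Fin n)) → Dec (IsPermutation w)
  isPermutation? w = all? (λ a → a ∈? w) ×-dec unique? w
    where
    open import Data.List.Membership.DecPropositional _≟_ using (_∈?_)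
    open import Data.List.Relation.Unary.Unique.DecPropositional _≟_ using (unique?)

  words : ∀ n → ℕ → List (List (Fin n))
  words n zero    = [] ∷ []
  words n (suc l) = [] ∷ cartesianProductWith _∷_ (allFin n) (words n l)

  ∈-words : ∀ {n} l (w : List (Fin n)) → length w ≤ l → w ∈ words n l
  ∈-words zero    []      _       = here refl
  ∈-words (suc l) []      _       = here refl
  ∈-words (suc l) (a ∷ w) (s≤s p) =
    there (∈-cartesianProductWith⁺ _∷_ (∈-allFin a) (∈-words l w p))

  lookup-injective : ∀ {A : Set} {xs : List A} → Unique xs →
                     ∀ {i j} → lookup xs i ≡ lookup xs j → i ≡ j
  lookup-injective {xs = x ∷ xs} (x∉ ∷ u) {Fin.zero}  {Fin.zero}  _ = refl
  lookup-injective {xs = x ∷ xs} (x∉ ∷ u) {Fin.zero}  {Fin.suc j} e =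
    contradiction e (All.lookup x∉ (∈-lookup j))
  lookup-injective {xs = x ∷ xs} (x∉ ∷ u) {Fin.suc i} {Fin.zero}  e =
    contradiction (sym e) (All.lookup x∉ (∈-lookup i))
  lookup-injective {xs = x ∷ xs} (x∉ ∷ u) {Fin.suc i} {Fin.suc j} e =
    cong Fin.suc (lookup-injective u e)

  identity : ∀ n → 𝒫 n
  identity n = allFin n , ∈-allFin , allFin⁺ n

-- The hypothesis on f: its value does not depend on the proof that the
-- word is a permutation.
minOver𝒫 : ∀ {n} (f : 𝒫 n → ℕ) → (∀ σ τ → word σ ≡ word τ → f σ ≡ f τ) →
           ∃[ m ] IsMinimum f m
minOver𝒫 {n} f f-resp =
  let σ , _ , least = best (words n n)
  in  f σ , (σ , refl) , λ τ →
        least τ (∈-words n (word τ) (injective⇒≤ (lookup-injective (proj₂ (isPermutation τ)))))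
  where
  best : (ws : List (List (Fin n))) →
         ∃[ σ ] f σ ≤ f (identity n) × (∀ τ → word τ ∈ ws → f σ ≤ f τ)
  best []       = identity n , ≤-refl , λ _ ()
  best (w ∷ ws) with best ws | isPermutation? w
  ... | σ , σ≤ , least | no ¬perm = σ , σ≤ ,
    λ { τ (here e)  → contradiction (subst IsPermutation e (isPermutation τ)) ¬perm
      ; τ (there i) → least τ i }
  ... | σ , σ≤ , least | yes perm with ℕₚ.≤-total (f σ) (f (w , perm))
  ...   | inj₁ σ≤w = σ , σ≤ ,
    λ { τ (here e)  → ≤-trans σ≤w (≤-reflexive (f-resp _ _ (sym e)))
      ; τ (there i) → least τ i }
  ...   | inj₂ w≤σ = (w , perm) , ≤-trans w≤σ σ≤ ,
    λ { τ (here e)  → ≤-reflexive (f-resp _ _ (sym e))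
      ; τ (there i) → ≤-trans w≤σ (least τ i) }

------------------------------------------------------------------------
-- Ulam median and Ulam center

-- A family rather than a set of permutations, so repetitions are counted.
record Instance : Set where
  constructor inst
  field
    k d           : ℕ
    .{{nonEmpty}} : NonZero k
    perm          : Fin k → 𝒫 d

open Instance public using (k; d; perm)

cost : (Π : Instance) → 𝒫 (d Π) → ℕ
cost Π σ = sum (tabulate λ j → 𝒰 σ (perm Π j))

-- The family is nonempty, so the base value 0 does not affect the maximum.
rad : (Π : Instance) → 𝒫 (d Π) → ℕ
rad Π σ = max 0 (tabulate λ j → 𝒰 σ (perm Π j))

private

  cost-resp : ∀ Π σ τ → word σ ≡ word τ → cost Π σ ≡ cost Π τ
  cost-resp Π (w , _) (.w , _) refl = refl

  rad-resp : ∀ Π σ τ → word σ ≡ word τ → rad Π σ ≡ rad Π τ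
  rad-resp Π (w , _) (.w , _) refl = refl

OPT-med : Instance → ℕ
OPT-med Π = proj₁ (minOver𝒫 (cost Π) (cost-resp Π))

OPT-med-isMinimum : ∀ Π → IsMinimum (cost Π) (OPT-med Π)
OPT-med-isMinimum Π = proj₂ (minOver𝒫 (cost Π) (cost-resp Π))

OPT-ctr : Instance → ℕ
OPT-ctr Π = proj₁ (minOver𝒫 (rad Π) (rad-resp Π))

OPT-ctr-isMinimum : ∀ Π → IsMinimum (rad Π) (OPT-ctr Π)
OPT-ctr-isMinimum Π = proj₂ (minOver𝒫 (rad Π) (rad-resp Π))

------------------------------------------------------------------------
-- Machine model: while programs on binary trees
--
-- This is a one-variable, combinator-style form of N. D. Jones's WHILE
-- language (Computability and Complexity from a Programming
-- Perspective, 1997).  It is Turing complete.  Every operation has unit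
-- cost: with trees represented by pointers to shared nodes, each one
-- takes constant time on a pointer machine and allocates at most one
-- node, so its polynomial time is that of Turing machines (for outputs
-- that, as here, have polynomial size).

data Tree : Set where
  nil  : Tree
  _∙_  : Tree → Tree → Tree

infixr 5 _∙_

size : Tree → ℕ
size nil     = 1
size (s ∙ t) = suc (size s + size t)

infixr 4 _⨾_

data Program : Set where
  skip             : Program                      -- return the input
  const-nil hd tl  : Program
  _⨾_              : Program → Program → Program  -- left one first
  cons             : Program → Program → Program  -- both run on the input
  if_then_else_    : Program → Program → Program → Program
  while_loop_      : Program → Program → Program

private variable
  p q r         : Program
  s t u v x y z : Tree
  m n l         : ℕ

infix 3 _⊢_⇓_∣_

-- p ⊢ x ⇓ y ∣ n : on input x, program p halts with output y after n steps.
-- nil is the truth value false and every other tree is true.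
data _⊢_⇓_∣_ : Program → Tree → Tree → ℕ → Set where
  skip        : skip ⊢ x ⇓ x ∣ 1
  const-nil   : const-nil ⊢ x ⇓ nil ∣ 1
  hd-nil      : hd ⊢ nil ⇓ nil ∣ 1
  hd-∙        : hd ⊢ s ∙ t ⇓ s ∣ 1
  tl-nil      : tl ⊢ nil ⇓ nil ∣ 1
  tl-∙        : tl ⊢ s ∙ t ⇓ t ∣ 1
  seq         : p ⊢ x ⇓ y ∣ m → q ⊢ y ⇓ z ∣ n → p ⨾ q ⊢ x ⇓ z ∣ suc (m + n)
  cons        : p ⊢ x ⇓ s ∣ m → q ⊢ x ⇓ t ∣ n → cons p q ⊢ x ⇓ s ∙ t ∣ suc (m + n)
  if-true     : p ⊢ x ⇓ s ∙ t ∣ l → q ⊢ x ⇓ y ∣ m →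
                if p then q else r ⊢ x ⇓ y ∣ suc (l + m)
  if-false    : p ⊢ x ⇓ nil ∣ l → r ⊢ x ⇓ y ∣ m →
                if p then q else r ⊢ x ⇓ y ∣ suc (l + m)
  while-true  : p ⊢ x ⇓ s ∙ t ∣ l → q ⊢ x ⇓ y ∣ m → while p loop q ⊢ y ⇓ z ∣ n →
                while p loop q ⊢ x ⇓ z ∣ suc (l + m + n)
  while-false : p ⊢ x ⇓ nil ∣ l → while p loop q ⊢ x ⇓ x ∣ suc l

-- One program and one polynomial bound c·N^e + c serve all inputs; N is
-- the size of the encoded input.
PolyTime : {A : Set} {B : A → Set} →
           (A → Tree) → (∀ {a} → B a → Tree) → ((a : A) → B a) → Set
PolyTime {A} encA encB f =
  Σ Program λ p → ∃[ c ] ∃[ e ] ∀ (a : A) →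
    ∃[ n ] (p ⊢ encA a ⇓ encB (f a) ∣ n) × n ≤ c * size (encA a) ^ e + c

------------------------------------------------------------------------
-- Encodings
--
-- Symbols are written in unary.  Since k ≥ 1, an instance over Fin d
-- lists at least d symbols, each of value below d, so this changes input
-- sizes only polynomially compared with binary notation.

⌜_⌝ℕ : ℕ → Tree
⌜ zero ⌝ℕ  = nil
⌜ suc n ⌝ℕ = nil ∙ ⌜ n ⌝ℕ

⌜_⌝L : List Tree → Tree
⌜ [] ⌝L     = nil
⌜ t ∷ ts ⌝L = t ∙ ⌜ ts ⌝L

⌜_⌝𝒫 : ∀ {n} → 𝒫 n → Tree
⌜ σ ⌝𝒫 = ⌜ map (λ a → ⌜ toℕ a ⌝ℕ) (word σ) ⌝L

⌜_⌝I : Instance → Tree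
⌜ Π ⌝I = ⌜ tabulate (λ j → ⌜ perm Π j ⌝𝒫) ⌝L

-- An instance together with a candidate center for its image.
⌜_⌝I×𝒫 : {𝒞 : Instance → Instance} → Σ Instance (λ Π → 𝒫 (d (𝒞 Π))) → Tree
⌜ Π , τ ⌝I×𝒫 = ⌜ Π ⌝I ∙ ⌜ τ ⌝𝒫

{-# OPTIONS --safe #-}
module Submission where

-- The j-th permutation σⱼ of the center instance is the concatenation over
-- i of π_{i+j mod k}, written in the i-th copy of the alphabet.  If ρᵢ is
-- the part of τ in the i-th copy, then 𝒰(τ, σⱼ) ≥ Σᵢ 𝒰(ρᵢ, π_{i+j}),
-- since LCS is subadditive over the copies.  For τ = ρρ…ρ every distance is at most
-- cost(ρ); conversely, summing over j gives k·rad(τ) ≥ Σᵢ cost(ρᵢ), so the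
-- cheapest ρᵢ costs at most rad(τ).

open import Data.Nat.Base using (ℕ; zero; suc; pred; _+_; _*_; _∸_; _^_; _≤_; _⊔_; z≤n; s≤s)
open import Data.Nat.DivMod using (_%_; _mod_; [m+n]%n≡m%n; m<n⇒m%n≡m)
open import Data.Nat.ListAction using (sum)
open import Data.Nat.Properties
open import Data.Nat.Tactic.RingSolver using (solve-∀)
open import Data.Fin.Base using (Fin; toℕ; _↑ˡ_; _↑ʳ_; splitAt)
open import Data.Fin.Properties as Fin
  using (toℕ-injective; toℕ-↑ˡ; toℕ-↑ʳ; toℕ-fromℕ<; toℕ<n; splitAt-↑ˡ; splitAt-↑ʳ; splitAt⁻¹-↑ˡ; splitAt⁻¹-↑ʳ)
open import Data.List.Base
  using (List; []; _∷_; _++_; map; foldl; foldr; length; replicate; mapMaybe; applyUpTo; tabulate; reverse; _ʳ++_)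
open import Data.List.Properties
open import Data.List.Extrema.Nat using (xs≤max; max≤v⁺)
open import Data.List.Membership.Propositional using (_∈_)
open import Data.List.Membership.Propositional.Properties using (∈-allFin; ∈-map⁺; ∈-map⁻; ∈-++⁺ˡ; ∈-++⁺ʳ)
open import Data.List.Membership.Propositional.Properties.WithK using (unique∧set⇒bag)
open import Data.List.Relation.Binary.BagAndSetEquality using (∼bag⇒↭)
open import Data.List.Relation.Binary.Disjoint.Propositional using (Disjoint)
open import Data.List.Relation.Binary.Permutation.Propositional.Properties using (↭-length)
open import Data.List.Relation.Binary.Sublist.Propositional using (_⊆_; []; _∷_; _∷ʳ_)
open import Data.List.Relation.Binary.Sublist.Propositional.Properties using (length-mono-≤)
  renaming (map⁺ to ⊆-map⁺; ++⁺ to ⊆-++⁺)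
open import Data.List.Relation.Unary.All as All using (All; []; _∷_)
import Data.List.Relation.Unary.All.Properties as All
open import Data.List.Relation.Unary.AllPairs using ([]; _∷_)
open import Data.List.Relation.Unary.Any using (here; there)
open import Data.List.Relation.Unary.Unique.Propositional using (Unique)
import Data.List.Relation.Unary.Unique.Propositional.Properties as Unique
open import Data.Maybe.Base using (Maybe; just; nothing)
open import Data.Product.Base using (Σ-syntax; ∃-syntax; _×_; _,_; proj₁; proj₂; uncurry)
open import Data.Sum using (inj₁; inj₂; isInj₁; isInj₂)
open import Data.Unit.Base using (⊤; tt)
open import Function.Base using (_∘_)
open import Function.Bundles using (mk⇔)
open import Relation.Binary.PropositionalEquality
open import Relation.Nullary using (yes; no; contradiction)
open import Defs

-- Polynomial-time programs

-- The statement asks for concrete `Program`s, so much of the work lies in the two polynomial-time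
-- claims. Programs are not analysed one by one: functions that come with a program, a time
-- polynomial and a size polynomial are shown to be closed under composition, branching and folds.
-- Folds are the delicate case, because iterating a polynomial-time step can produce exponentially
-- large values; each fold therefore needs its own size bound. The programs see only lists of
-- numbers. Neither the alphabet size `d` nor indices modulo `k` are given to them: `d` is read off
-- as the length of the first word, and the families π_{i+j} arise by rotating the list. On the
-- proof side a family is a periodic function on ℕ, so that a rotation is a mere shift of the
-- argument. Picking the cheapest block requires costs, hence longest common subsequences; the
-- recursion defining `lcs` calls itself three times and would take exponential time, so a
-- row-by-row computation replaces it and is proved equal to it.

infixl 6 _⊞_
infixl 7 _⊠_
infixr 8 _⊙_

data Poly : Set where
  var         : Poly
  con         : ℕ → Poly
  _⊞_ _⊠_ _⊙_ : Poly → Poly → Poly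

eval : Poly → ℕ → ℕ
eval var     n = n
eval (con c) n = c
eval (P ⊞ Q) n = eval P n + eval Q n
eval (P ⊠ Q) n = eval P n * eval Q n
eval (P ⊙ Q) n = eval P (eval Q n)

eval-mono : ∀ P {m n} → m ≤ n → eval P m ≤ eval P n
eval-mono var     m≤n = m≤n
eval-mono (con c) m≤n = ≤-refl
eval-mono (P ⊞ Q) m≤n = +-mono-≤ (eval-mono P m≤n) (eval-mono Q m≤n)
eval-mono (P ⊠ Q) m≤n = *-mono-≤ (eval-mono P m≤n) (eval-mono Q m≤n)
eval-mono (P ⊙ Q) m≤n = eval-mono P (eval-mono Q m≤n)

*-interchange : ∀ a b c d → (a * b) * (c * d) ≡ (a * c) * (b * d)
*-interchange = solve-∀

^-distribʳ-* : ∀ e m n → (m * n) ^ e ≡ m ^ e * n ^ e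
^-distribʳ-* zero    m n = refl
^-distribʳ-* (suc e) m n = begin
  m * n * (m * n) ^ e        ≡⟨ cong (m * n *_) (^-distribʳ-* e m n) ⟩
  m * n * (m ^ e * n ^ e)    ≡⟨ *-interchange m n (m ^ e) (n ^ e) ⟩
  m * m ^ e * (n * n ^ e)    ∎
  where open ≡-Reasoning

-- Different exponents are made equal by enlarging them, which needs a base of at least 1. Hence the
-- bound is stated for `suc n`; sizes of trees are positive.
eval-bounded : ∀ P → ∃[ c ] ∃[ e ] ∀ n → eval P (suc n) ≤ c * suc n ^ e
eval-bounded var     = 1 , 1 , λ n →
  ≤-reflexive (sym (trans (*-identityˡ _) (*-identityʳ (suc n))))
eval-bounded (con c) = c , 0 , λ n → ≤-reflexive (sym (*-identityʳ c))
eval-bounded (P ⊞ Q) with eval-bounded P | eval-bounded Q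
... | c₁ , e₁ , b₁ | c₂ , e₂ , b₂ = c₁ + c₂ , e₁ + e₂ , λ n → begin
  eval P (suc n) + eval Q (suc n)                         ≤⟨ +-mono-≤ (b₁ n) (b₂ n) ⟩
  c₁ * suc n ^ e₁ + c₂ * suc n ^ e₂                       ≤⟨ +-mono-≤
    (*-monoʳ-≤ c₁ (^-monoʳ-≤ (suc n) (m≤m+n e₁ e₂)))
    (*-monoʳ-≤ c₂ (^-monoʳ-≤ (suc n) (m≤n+m e₂ e₁))) ⟩
  c₁ * suc n ^ (e₁ + e₂) + c₂ * suc n ^ (e₁ + e₂)         ≡⟨ *-distribʳ-+ _ c₁ c₂ ⟨
  (c₁ + c₂) * suc n ^ (e₁ + e₂)                           ∎
  where open ≤-Reasoning
eval-bounded (P ⊠ Q) with eval-bounded P | eval-bounded Q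
... | c₁ , e₁ , b₁ | c₂ , e₂ , b₂ = c₁ * c₂ , e₁ + e₂ , λ n → begin
  eval P (suc n) * eval Q (suc n)              ≤⟨ *-mono-≤ (b₁ n) (b₂ n) ⟩
  (c₁ * suc n ^ e₁) * (c₂ * suc n ^ e₂)        ≡⟨ *-interchange c₁ _ c₂ _ ⟩
  (c₁ * c₂) * (suc n ^ e₁ * suc n ^ e₂)        ≡⟨ cong (c₁ * c₂ *_) (^-distribˡ-+-* (suc n) e₁ e₂) ⟨
  (c₁ * c₂) * suc n ^ (e₁ + e₂)                ∎
  where open ≤-Reasoning
eval-bounded (P ⊙ Q) with eval-bounded P | eval-bounded Q
... | c₁ , e₁ , b₁ | c₂ , e₂ , b₂ = c₁ * suc c₂ ^ e₁ , e₂ * e₁ , λ n → begin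
  eval P (eval Q (suc n))                      ≤⟨ eval-mono P (b₂ n) ⟩
  -- `c₂` may be 0, while the bound for `P` covers positive arguments only.
  eval P (c₂ * suc n ^ e₂)                     ≤⟨ eval-mono P (*-monoˡ-≤ (suc n ^ e₂) (n≤1+n c₂)) ⟩
  eval P (suc c₂ * suc n ^ e₂)                 ≤⟨ bound _ (*-mono-≤ (s≤s (z≤n {c₂})) (m^n>0 (suc n) e₂)) ⟩
  c₁ * (suc c₂ * suc n ^ e₂) ^ e₁              ≡⟨ cong (c₁ *_) (^-distribʳ-* e₁ (suc c₂) _) ⟩
  c₁ * (suc c₂ ^ e₁ * (suc n ^ e₂) ^ e₁)       ≡⟨ *-assoc c₁ _ _ ⟨
  c₁ * suc c₂ ^ e₁ * (suc n ^ e₂) ^ e₁         ≡⟨ cong (c₁ * suc c₂ ^ e₁ *_) (^-*-assoc (suc n) e₂ e₁) ⟩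
  c₁ * suc c₂ ^ e₁ * suc n ^ (e₂ * e₁)         ∎
  where
  open ≤-Reasoning
  bound : ∀ m → 1 ≤ m → eval P m ≤ c₁ * m ^ e₁
  bound (suc m) _ = b₁ m

infix 3 _⊢_⇓_within_

-- Only an upper bound is tracked, so that bounds for parts of a program can be enlarged to
-- polynomials before they are combined.
_⊢_⇓_within_ : Program → Tree → Tree → ℕ → Set
p ⊢ x ⇓ y within m = ∃[ n ] (p ⊢ x ⇓ y ∣ n) × n ≤ m

weaken : ∀ {p x y m n} →
  m ≤ n → p ⊢ x ⇓ y within m → p ⊢ x ⇓ y within n
weaken m≤n (_ , run , le) = _ , run , ≤-trans le m≤n

seq-within : ∀ {p q x y z m n} →
  p ⊢ x ⇓ y within m → q ⊢ y ⇓ z within n → p ⨾ q ⊢ x ⇓ z within suc (m + n)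
seq-within (_ , r₁ , le₁) (_ , r₂ , le₂) = _ , seq r₁ r₂ , s≤s (+-mono-≤ le₁ le₂)

cons-within : ∀ {p q x s t m n} →
  p ⊢ x ⇓ s within m → q ⊢ x ⇓ t within n → cons p q ⊢ x ⇓ s ∙ t within suc (m + n)
cons-within (_ , r₁ , le₁) (_ , r₂ , le₂) = _ , cons r₁ r₂ , s≤s (+-mono-≤ le₁ le₂)

if-true-within : ∀ {p q r x y s t l m} →
  p ⊢ x ⇓ s ∙ t within l → q ⊢ x ⇓ y within m →
  if p then q else r ⊢ x ⇓ y within suc (l + m)
if-true-within (_ , r₁ , le₁) (_ , r₂ , le₂) = _ , if-true r₁ r₂ , s≤s (+-mono-≤ le₁ le₂)

if-false-within : ∀ {p q r x y l m} →
  p ⊢ x ⇓ nil within l → r ⊢ x ⇓ y within m →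
  if p then q else r ⊢ x ⇓ y within suc (l + m)
if-false-within (_ , r₁ , le₁) (_ , r₂ , le₂) = _ , if-false r₁ r₂ , s≤s (+-mono-≤ le₁ le₂)

while-true-within : ∀ {p q x y z s t l m n} →
  p ⊢ x ⇓ s ∙ t within l → q ⊢ x ⇓ y within m →
  while p loop q ⊢ y ⇓ z within n →
  while p loop q ⊢ x ⇓ z within suc (l + m + n)
while-true-within (_ , r₁ , le₁) (_ , r₂ , le₂) (_ , r₃ , le₃) =
  _ , while-true r₁ r₂ r₃ , s≤s (+-mono-≤ (+-mono-≤ le₁ le₂) le₃)

hd-within : ∀ {s t} → hd ⊢ s ∙ t ⇓ s within 1
hd-within = _ , hd-∙ , ≤-refl

tl-within : ∀ {s t} → tl ⊢ s ∙ t ⇓ t within 1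
tl-within = _ , tl-∙ , ≤-refl

-- Encodable types and functions computable in polynomial time

infixr 2 _⊗_

-- Permutations are absent: programs work on their codes, lists of numbers, and the properties that
-- make such a list a permutation are handled outside.
data Ty : Set where
  nat  : Ty
  list : Ty → Ty
  _⊗_  : Ty → Ty → Ty

⟦_⟧ : Ty → Set
⟦ nat ⟧    = ℕ
⟦ list A ⟧ = List ⟦ A ⟧
⟦ A ⊗ B ⟧  = ⟦ A ⟧ × ⟦ B ⟧

enc : ∀ A → ⟦ A ⟧ → Tree
enc nat      n       = ⌜ n ⌝ℕ
enc (list A) xs      = ⌜ map (enc A) xs ⌝L
enc (A ⊗ B)  (x , y) = enc A x ∙ enc B y

sz : ∀ A → ⟦ A ⟧ → ℕ
sz A x = size (enc A x)

size≥1 : ∀ t → 1 ≤ size t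
size≥1 nil     = ≤-refl
size≥1 (_ ∙ _) = s≤s z≤n

-- Both the running time and the size of the output are bounded: since
-- cons shares its input, the former does not bound the latter.
record Comp (Γ A : Ty) (f : ⟦ Γ ⟧ → ⟦ A ⟧) : Set where
  field
    prog  : Program
    time  : Poly
    space : Poly
    runs  : ∀ γ → prog ⊢ enc Γ γ ⇓ enc A (f γ) within eval time (sz Γ γ)
    fits  : ∀ γ → sz A (f γ) ≤ eval space (sz Γ γ)

open Comp

private variable
  Γ A B X : Ty

comp-≗ : ∀ {f g : ⟦ Γ ⟧ → ⟦ A ⟧} → (∀ γ → f γ ≡ g γ) → Comp Γ A f → Comp Γ A g
comp-≗ {Γ} {A} f≗g c = record
  { prog  = prog c
  ; time  = time c
  ; space = space c
  ; runs  = λ γ → subst (λ a → prog c ⊢ enc Γ γ ⇓ enc A a within eval (time c) (sz Γ γ)) (f≗g γ) (runs c γ)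
  ; fits  = λ γ → subst (λ a → sz A a ≤ eval (space c) (sz Γ γ)) (f≗g γ) (fits c γ)
  }

comp-id : Comp Γ Γ (λ γ → γ)
comp-id = record
  { prog = skip ; time = con 1 ; space = var
  ; runs = λ γ → _ , skip , ≤-refl ; fits = λ γ → ≤-refl }

comp-∘ : ∀ {f : ⟦ A ⟧ → ⟦ B ⟧} {g : ⟦ Γ ⟧ → ⟦ A ⟧} → Comp A B f → Comp Γ A g →
         Comp Γ B (λ γ → f (g γ))
comp-∘ {g = g} c₁ c₂ = record
  { prog  = prog c₂ ⨾ prog c₁
  ; time  = con 1 ⊞ (time c₂ ⊞ time c₁ ⊙ space c₂)
  ; space = space c₁ ⊙ space c₂
  ; runs  = λ γ → seq-within (runs c₂ γ) (weaken (eval-mono (time c₁) (fits c₂ γ)) (runs c₁ (g γ)))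
  ; fits  = λ γ → ≤-trans (fits c₁ (g γ)) (eval-mono (space c₁) (fits c₂ γ))
  }

comp-fst : Comp (A ⊗ B) A proj₁
comp-fst = record
  { prog = hd ; time = con 1 ; space = var
  ; runs = λ γ → hd-within ; fits = λ γ → m≤n⇒m≤1+n (m≤m+n _ _) }

comp-snd : Comp (A ⊗ B) B proj₂
comp-snd = record
  { prog = tl ; time = con 1 ; space = var
  ; runs = λ γ → tl-within ; fits = λ γ → m≤n⇒m≤1+n (m≤n+m _ _) }

comp-pair : ∀ {f : ⟦ Γ ⟧ → ⟦ A ⟧} {g : ⟦ Γ ⟧ → ⟦ B ⟧} → Comp Γ A f → Comp Γ B g →
            Comp Γ (A ⊗ B) (λ γ → f γ , g γ)
comp-pair c₁ c₂ = record
  { prog  = cons (prog c₁) (prog c₂)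
  ; time  = con 1 ⊞ (time c₁ ⊞ time c₂)
  ; space = con 1 ⊞ (space c₁ ⊞ space c₂)
  ; runs  = λ γ → cons-within (runs c₁ γ) (runs c₂ γ)
  ; fits  = λ γ → s≤s (+-mono-≤ (fits c₁ γ) (fits c₂ γ))
  }

comp-[] : Comp Γ (list A) (λ _ → [])
comp-[] = record
  { prog = const-nil ; time = con 1 ; space = con 1
  ; runs = λ γ → _ , const-nil , ≤-refl ; fits = λ γ → ≤-refl }

comp-zero : Comp Γ nat (λ _ → 0)
comp-zero = record
  { prog = const-nil ; time = con 1 ; space = con 1
  ; runs = λ γ → _ , const-nil , ≤-refl ; fits = λ γ → ≤-refl }

comp-∷ : ∀ {f : ⟦ Γ ⟧ → ⟦ A ⟧} {g : ⟦ Γ ⟧ → List ⟦ A ⟧} → Comp Γ A f → Comp Γ (list A) g →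
         Comp Γ (list A) (λ γ → f γ ∷ g γ)
comp-∷ c₁ c₂ = record
  { prog  = cons (prog c₁) (prog c₂)
  ; time  = con 1 ⊞ (time c₁ ⊞ time c₂)
  ; space = con 1 ⊞ (space c₁ ⊞ space c₂)
  ; runs  = λ γ → cons-within (runs c₁ γ) (runs c₂ γ)
  ; fits  = λ γ → s≤s (+-mono-≤ (fits c₁ γ) (fits c₂ γ))
  }

comp-suc : ∀ {f : ⟦ Γ ⟧ → ℕ} → Comp Γ nat f → Comp Γ nat (λ γ → suc (f γ))
comp-suc c = record
  { prog  = cons const-nil (prog c)
  ; time  = con 2 ⊞ time c
  ; space = con 2 ⊞ space c
  ; runs  = λ γ → cons-within (_ , const-nil , ≤-refl) (runs c γ)
  ; fits  = λ γ → s≤s (s≤s (fits c γ))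
  }

size-pred : ∀ n → size ⌜ pred n ⌝ℕ ≤ size ⌜ n ⌝ℕ
size-pred zero    = ≤-refl
size-pred (suc n) = m≤n+m _ 2

comp-pred : ∀ {f : ⟦ Γ ⟧ → ℕ} → Comp Γ nat f → Comp Γ nat (λ γ → pred (f γ))
comp-pred {f = f} c = record
  { prog  = prog c ⨾ tl
  ; time  = con 1 ⊞ (time c ⊞ con 1)
  ; space = space c
  ; runs  = λ γ → seq-within (runs c γ) (run (f γ))
  ; fits  = λ γ → ≤-trans (size-pred (f γ)) (fits c γ)
  }
  where
  run : ∀ n → tl ⊢ ⌜ n ⌝ℕ ⇓ ⌜ pred n ⌝ℕ within 1
  run zero    = _ , tl-nil , ≤-refl
  run (suc n) = tl-within

-- Zero is encoded as `nil`, the truth value false, so a number serves directly as a condition, with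
-- the branches of the program in the opposite order. Comparisons then reduce to `_∸_`, as `m ∸ n`
-- is zero exactly when m ≤ n.
if0 : {C : Set} → ℕ → C → C → C
if0 zero    x y = x
if0 (suc _) x y = y

comp-if0 : ∀ {h : ⟦ Γ ⟧ → ℕ} {f g : ⟦ Γ ⟧ → ⟦ A ⟧} → Comp Γ nat h → Comp Γ A f → Comp Γ A g →
           Comp Γ A (λ γ → if0 (h γ) (f γ) (g γ))
comp-if0 {Γ} {A} {h} {f} {g} c₁ c₂ c₃ = record
  { prog  = if prog c₁ then prog c₃ else prog c₂
  ; time  = con 1 ⊞ (time c₁ ⊞ (time c₂ ⊞ time c₃))
  ; space = space c₂ ⊞ space c₃
  ; runs  = run
  ; fits  = fit
  }
  where
  run : ∀ γ → if prog c₁ then prog c₃ else prog c₂ ⊢ enc Γ γ ⇓ enc A (if0 (h γ) (f γ) (g γ)) within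
        suc (eval (time c₁) (sz Γ γ) + (eval (time c₂) (sz Γ γ) + eval (time c₃) (sz Γ γ)))
  run γ with h γ | runs c₁ γ
  ... | zero  | run₁ = if-false-within run₁ (weaken (m≤m+n _ _) (runs c₂ γ))
  ... | suc _ | run₁ = if-true-within run₁ (weaken (m≤n+m _ _) (runs c₃ γ))
  fit : ∀ γ → sz A (if0 (h γ) (f γ) (g γ)) ≤ eval (space c₂) (sz Γ γ) + eval (space c₃) (sz Γ γ)
  fit γ with h γ
  ... | zero  = ≤-trans (fits c₂ γ) (m≤m+n _ _)
  ... | suc _ = ≤-trans (fits c₃ γ) (m≤n+m _ _)

caseList : {C D : Set} → List C → D → (C → List C → D) → D
caseList []       n c = n
caseList (x ∷ xs) n c = c x xs

comp-case : ∀ {l : ⟦ Γ ⟧ → List ⟦ X ⟧} {f : ⟦ Γ ⟧ → ⟦ A ⟧} {g : ⟦ Γ ⟧ × (⟦ X ⟧ × List ⟦ X ⟧) → ⟦ A ⟧} →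
            Comp Γ (list X) l → Comp Γ A f → Comp (Γ ⊗ (X ⊗ list X)) A g →
            Comp Γ A (λ γ → caseList (l γ) (f γ) (λ x xs → g (γ , (x , xs))))
comp-case {Γ} {X} {A} {l} {f} {g} c₁ c₂ c₃ = record
  { prog  = P
  ; time  = T
  ; space = S
  ; runs  = run
  ; fits  = fit
  }
  where
  -- A nonempty list is encoded by the same tree as the pair of its head and tail, so the list is
  -- passed to the branch as it is.
  P = if prog c₁ then (cons skip (prog c₁) ⨾ prog c₃) else prog c₂
  U = con 1 ⊞ (var ⊞ space c₁)
  T = con 1 ⊞ (time c₁ ⊞ (time c₂ ⊞ (con 3 ⊞ (time c₁ ⊞ time c₃ ⊙ U))))
  S = space c₂ ⊞ space c₃ ⊙ U
  run : ∀ γ → P ⊢ enc Γ γ ⇓ enc A (caseList (l γ) (f γ) (λ x xs → g (γ , (x , xs)))) within eval T (sz Γ γ)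
  run γ with l γ | runs c₁ γ | fits c₁ γ
  ... | []     | run₁ | _   = if-false-within run₁ (weaken (m≤m+n _ _) (runs c₂ γ))
  ... | x ∷ xs | run₁ | fit = if-true-within run₁ (weaken (m≤n+m _ (eval (time c₂) (sz Γ γ)))
    (seq-within (cons-within (_ , skip , ≤-refl) run₁)
      (weaken (eval-mono (time c₃) (s≤s (+-monoʳ-≤ (sz Γ γ) fit))) (runs c₃ (γ , (x , xs))))))
  fit : ∀ γ → sz A (caseList (l γ) (f γ) (λ x xs → g (γ , (x , xs)))) ≤ eval S (sz Γ γ)
  fit γ with l γ | fits c₁ γ
  ... | []     | _  = ≤-trans (fits c₂ γ) (m≤m+n _ _)
  ... | x ∷ xs | le = ≤-trans (fits c₃ (γ , (x , xs))) (≤-trans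
    (eval-mono (space c₃) (s≤s (+-monoʳ-≤ (sz Γ γ) le))) (m≤n+m _ (eval (space c₂) (sz Γ γ))))

-- Folds with bounded accumulators

sz-++ : ∀ A (xs ys : List ⟦ A ⟧) → suc (sz (list A) (xs ++ ys)) ≡ sz (list A) xs + sz (list A) ys
sz-++ A []       ys = refl
sz-++ A (x ∷ xs) ys = cong suc (begin
  suc (sz A x + sz (list A) (xs ++ ys))           ≡⟨ +-suc (sz A x) _ ⟨
  sz A x + suc (sz (list A) (xs ++ ys))           ≡⟨ cong (sz A x +_) (sz-++ A xs ys) ⟩
  sz A x + (sz (list A) xs + sz (list A) ys)      ≡⟨ +-assoc (sz A x) _ _ ⟨
  sz A x + sz (list A) xs + sz (list A) ys        ∎)
  where open ≡-Reasoning

sz-prefix : ∀ A (xs ys : List ⟦ A ⟧) → sz (list A) xs ≤ sz (list A) (xs ++ ys)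
sz-prefix A xs ys = ≤-pred (begin
  suc (sz (list A) xs)                 ≡⟨ +-comm 1 _ ⟩
  sz (list A) xs + 1                   ≤⟨ +-monoʳ-≤ _ (size≥1 (enc (list A) ys)) ⟩
  sz (list A) xs + sz (list A) ys      ≡⟨ sz-++ A xs ys ⟨
  suc (sz (list A) (xs ++ ys))         ∎)
  where open ≤-Reasoning

sz-suffix : ∀ A (xs ys : List ⟦ A ⟧) → sz (list A) ys ≤ sz (list A) (xs ++ ys)
sz-suffix A xs ys = ≤-pred (begin
  suc (sz (list A) ys)                 ≤⟨ +-monoˡ-≤ _ (size≥1 (enc (list A) xs)) ⟩
  sz (list A) xs + sz (list A) ys      ≡⟨ sz-++ A xs ys ⟨
  suc (sz (list A) (xs ++ ys))         ∎)
  where open ≤-Reasoning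

sz-reverse : ∀ A (xs : List ⟦ A ⟧) → sz (list A) (reverse xs) ≡ sz (list A) xs
sz-reverse A []       = refl
sz-reverse A (x ∷ xs) = suc-injective (begin
  suc (sz (list A) (reverse (x ∷ xs)))                  ≡⟨ cong (λ zs → suc (sz (list A) zs)) (unfold-reverse x xs) ⟩
  suc (sz (list A) (reverse xs ++ x ∷ []))              ≡⟨ sz-++ A (reverse xs) (x ∷ []) ⟩
  sz (list A) (reverse xs) + suc (sz A x + 1)           ≡⟨ cong (_+ suc (sz A x + 1)) (sz-reverse A xs) ⟩
  sz (list A) xs + suc (sz A x + 1)                     ≡⟨ rearrange (sz (list A) xs) (sz A x) ⟩
  suc (suc (sz A x + sz (list A) xs))                   ∎)
  where
  open ≡-Reasoning
  rearrange : ∀ m n → m + suc (n + 1) ≡ suc (suc (n + m))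
  rearrange = solve-∀

length≤sz : ∀ A (xs : List ⟦ A ⟧) → length xs ≤ sz (list A) xs
length≤sz A []       = z≤n
length≤sz A (x ∷ xs) = s≤s (≤-trans (length≤sz A xs) (m≤n+m _ (sz A x)))

-- The state of the loop is (remaining list , (accumulator , environment)).
comp-foldl : ∀ {f : ⟦ Γ ⟧ × (⟦ X ⟧ × ⟦ A ⟧) → ⟦ A ⟧} {i : ⟦ Γ ⟧ → ⟦ A ⟧} {l : ⟦ Γ ⟧ → List ⟦ X ⟧} →
             Comp (Γ ⊗ (X ⊗ A)) A f → Comp Γ A i → Comp Γ (list X) l →
             (P : Poly) →
             (∀ γ xs → sz A (foldl (λ a x → f (γ , (x , a))) (i γ) xs) ≤ eval P (sz Γ γ + sz (list X) xs)) →
             Comp Γ A (λ γ → foldl (λ a x → f (γ , (x , a))) (i γ) (l γ))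
comp-foldl {Γ} {X} {A} {f} {i} {l} step init xsC P bound = record
  { prog  = cons (prog xsC) (cons (prog init) skip) ⨾ (loopProg ⨾ (tl ⨾ hd))
  -- A round costs 22 steps besides `step`; the setup, the last failing test and the extraction of
  -- the accumulator make up the 10.
  ; time  = con 10 ⊞ (time xsC ⊞ time init) ⊞ space xsC ⊠ (con 22 ⊞ time step ⊙ U)
  ; space = S
  ; runs  = λ γ → weaken (total γ) (seq-within
      (cons-within (runs xsC γ) (cons-within (runs init γ) (_ , skip , ≤-refl)))
      (seq-within (iterate γ [] (l γ) refl) (seq-within tl-within hd-within)))
  ; fits  = λ γ → fold-fits γ (l γ) (fits xsC γ)
  }
  where
  S U : Poly
  S = P ⊙ (var ⊞ space xsC)
  U = con 2 ⊞ (var ⊞ (space xsC ⊞ S))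
  loopProg : Program
  loopProg = while hd loop
    cons (hd ⨾ tl)
         (cons (cons (tl ⨾ tl) (cons (hd ⨾ hd) (tl ⨾ hd)) ⨾ prog step) (tl ⨾ tl))
  fold : ⟦ Γ ⟧ → List ⟦ X ⟧ → ⟦ A ⟧
  fold γ = foldl (λ a x → f (γ , (x , a))) (i γ)
  -- The hypothesis `bound` covers every list, so it also bounds the accumulator after each prefix.
  fold-fits : ∀ γ xs → sz (list X) xs ≤ eval (space xsC) (sz Γ γ) → sz A (fold γ xs) ≤ eval S (sz Γ γ)
  fold-fits γ xs le = ≤-trans (bound γ xs) (eval-mono P (+-monoʳ-≤ (sz Γ γ) le))
  state : ⟦ Γ ⟧ → List ⟦ X ⟧ → ⟦ A ⟧ → Tree
  state γ xs a = enc (list X) xs ∙ (enc A a ∙ enc Γ γ)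
  T : ⟦ Γ ⟧ → ℕ
  T γ = eval (time step ⊙ U) (sz Γ γ)
  shuffle : ∀ a b c → suc (a + suc (b + c)) ≡ 2 + (a + (b + c))
  shuffle = solve-∀
  step-runs : ∀ γ ys z zs → ys ++ z ∷ zs ≡ l γ →
              prog step ⊢ enc (Γ ⊗ (X ⊗ A)) (γ , (z , fold γ ys)) ⇓ enc A (fold γ (ys ++ z ∷ [])) within T γ
  step-runs γ ys z zs eq rewrite foldl-++ (λ a x → f (γ , (x , a))) (i γ) ys (z ∷ []) =
    weaken (eval-mono (time step) (≤-trans (≤-reflexive (shuffle (sz Γ γ) (sz X z) _))
      (s≤s (s≤s (+-monoʳ-≤ (sz Γ γ) (+-mono-≤ z-fits (fold-fits γ ys ys-fits)))))))
      (runs step (γ , (z , fold γ ys)))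
    where
    le : sz (list X) (ys ++ z ∷ zs) ≤ eval (space xsC) (sz Γ γ)
    le rewrite eq = fits xsC γ
    z-fits = ≤-trans (m≤n⇒m≤1+n (m≤m+n (sz X z) (sz (list X) zs))) (≤-trans (sz-suffix X ys (z ∷ zs)) le)
    ys-fits = ≤-trans (sz-prefix X ys (z ∷ zs)) le
  -- `ys` is the part already consumed: the accumulator keeps the form `fold γ ys`, for which a size
  -- bound is known.
  iterate : ∀ γ ys zs → ys ++ zs ≡ l γ →
         loopProg ⊢ state γ zs (fold γ ys) ⇓ state γ [] (fold γ (l γ)) within length zs * (22 + T γ) + 2
  iterate γ ys [] eq rewrite sym eq | ++-identityʳ ys = _ , while-false hd-∙ , ≤-refl
  iterate γ ys (z ∷ zs) eq = weaken (≤-reflexive (arith (T γ) _)) (while-true-within hd-within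
    (cons-within (seq-within hd-within tl-within)
      (cons-within
        (seq-within
          (cons-within (seq-within tl-within tl-within)
            (cons-within (seq-within hd-within hd-within) (seq-within tl-within hd-within)))
          (step-runs γ ys z zs eq))
        (seq-within tl-within tl-within)))
    (iterate γ (ys ++ z ∷ []) zs (trans (++-assoc ys (z ∷ []) zs) eq)))
    where
    arith : ∀ t n → suc (1 + suc (3 + suc (suc (suc (3 + 7) + t) + 3)) + (n + 2)) ≡ 22 + t + n + 2
    arith = solve-∀
  total : ∀ γ → suc (suc (eval (time xsC) (sz Γ γ) + suc (eval (time init) (sz Γ γ) + 1)) +
                     suc (length (l γ) * (22 + T γ) + 2 + 3))
              ≤ 10 + (eval (time xsC) (sz Γ γ) + eval (time init) (sz Γ γ)) +
                eval (space xsC) (sz Γ γ) * (22 + T γ)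
  total γ = ≤-trans (≤-reflexive (arith (eval (time xsC) (sz Γ γ)) (eval (time init) (sz Γ γ)) (length (l γ) * (22 + T γ))))
    (+-monoʳ-≤ (10 + (eval (time xsC) (sz Γ γ) + eval (time init) (sz Γ γ)))
      (*-monoˡ-≤ (22 + T γ) (≤-trans (length≤sz X (l γ)) (fits xsC γ))))
    where
    arith : ∀ a b n → suc (suc (a + suc (b + 1)) + suc (n + 2 + 3)) ≡ 10 + (a + b) + n
    arith = solve-∀

comp-reverse : ∀ {l : ⟦ Γ ⟧ → List ⟦ A ⟧} → Comp Γ (list A) l → Comp Γ (list A) (λ γ → reverse (l γ))
comp-reverse {Γ} {A} c = comp-foldl
  (comp-∷ (comp-∘ comp-fst comp-snd) (comp-∘ comp-snd comp-snd)) comp-[] c var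
  (λ γ xs → ≤-trans (≤-reflexive (sz-reverse A xs)) (m≤n+m _ (sz Γ γ)))

-- The loop consumes a list from its head, so the list is reversed first; reversal preserves the
-- encoded size, which carries the bound over.
comp-foldr : ∀ {f : ⟦ Γ ⟧ × (⟦ X ⟧ × ⟦ A ⟧) → ⟦ A ⟧} {i : ⟦ Γ ⟧ → ⟦ A ⟧} {l : ⟦ Γ ⟧ → List ⟦ X ⟧} →
             Comp (Γ ⊗ (X ⊗ A)) A f → Comp Γ A i → Comp Γ (list X) l →
             (P : Poly) →
             (∀ γ xs → sz A (foldr (λ x a → f (γ , (x , a))) (i γ) xs) ≤ eval P (sz Γ γ + sz (list X) xs)) →
             Comp Γ A (λ γ → foldr (λ x a → f (γ , (x , a))) (i γ) (l γ))
comp-foldr {Γ} {X} {A} {f} {i} {l} step init xsC P bound =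
  comp-≗ (λ γ → reverse-foldl (λ a x → f (γ , (x , a))) (i γ) (l γ))
    (comp-foldl step init (comp-reverse xsC) P bound′)
  where
  bound′ : ∀ γ xs → sz A (foldl (λ a x → f (γ , (x , a))) (i γ) xs) ≤ eval P (sz Γ γ + sz (list X) xs)
  bound′ γ xs = subst₂ (λ a n → sz A a ≤ eval P (sz Γ γ + n))
    (trans (sym (reverse-foldl (λ a x → f (γ , (x , a))) (i γ) (reverse xs)))
           (cong (foldl (λ a x → f (γ , (x , a))) (i γ)) (reverse-involutive xs)))
    (sz-reverse X xs)
    (bound γ (reverse xs))

-- Additive growth survives iteration: if the amount added by a step depends only on the environment
-- and the list item, the total is at most the length times that amount. A bound polynomial in the
-- accumulator itself would not suffice. `Inv` restricts the condition to accumulators satisfying an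
-- invariant of the loop.
foldl-growth : ∀ Γ X A {γ : ⟦ Γ ⟧} {f : ⟦ Γ ⟧ × (⟦ X ⟧ × ⟦ A ⟧) → ⟦ A ⟧} (Inv : ⟦ A ⟧ → Set) (G : Poly) →
  (∀ x a → Inv a → Inv (f (γ , (x , a))) × sz A (f (γ , (x , a))) ≤ sz A a + eval G (sz Γ γ + sz X x)) →
  ∀ a → Inv a → ∀ xs →
  sz A (foldl (λ a x → f (γ , (x , a))) a xs) ≤ sz A a + length xs * eval G (sz Γ γ + sz (list X) xs)
foldl-growth Γ X A Inv G grows a inv [] = m≤m+n _ 0
foldl-growth Γ X A {γ} {f} Inv G grows a inv (x ∷ xs) with grows x a inv
... | inv′ , le = begin
  sz A (foldl _ (f (γ , (x , a))) xs)
    ≤⟨ foldl-growth Γ X A {γ} {f} Inv G grows _ inv′ xs ⟩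
  sz A (f (γ , (x , a))) + length xs * eval G (sz Γ γ + sz (list X) xs)
    ≤⟨ +-mono-≤ le (*-monoʳ-≤ (length xs) (eval-mono G (+-monoʳ-≤ (sz Γ γ) (m≤n⇒m≤1+n (m≤n+m _ (sz X x)))))) ⟩
  sz A a + eval G (sz Γ γ + sz X x) + length xs * eval G (sz Γ γ + sz (list X) (x ∷ xs))
    ≤⟨ +-monoˡ-≤ _ (+-monoʳ-≤ (sz A a) (eval-mono G (+-monoʳ-≤ (sz Γ γ) (m≤n⇒m≤1+n (m≤m+n (sz X x) _))))) ⟩
  sz A a + eval G (sz Γ γ + sz (list X) (x ∷ xs)) + length xs * eval G (sz Γ γ + sz (list X) (x ∷ xs))
    ≡⟨ +-assoc (sz A a) _ _ ⟩
  sz A a + length (x ∷ xs) * eval G (sz Γ γ + sz (list X) (x ∷ xs)) ∎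
  where open ≤-Reasoning

comp-foldl-growth :
  ∀ {f : ⟦ Γ ⟧ × (⟦ X ⟧ × ⟦ A ⟧) → ⟦ A ⟧} {i : ⟦ Γ ⟧ → ⟦ A ⟧} {l : ⟦ Γ ⟧ → List ⟦ X ⟧}
  (Inv : ⟦ Γ ⟧ → ⟦ A ⟧ → Set) (G : Poly) → (∀ γ → Inv γ (i γ)) →
  (∀ γ x a → Inv γ a →
    Inv γ (f (γ , (x , a))) × sz A (f (γ , (x , a))) ≤ sz A a + eval G (sz Γ γ + sz X x)) →
  Comp (Γ ⊗ (X ⊗ A)) A f → Comp Γ A i → Comp Γ (list X) l →
  Comp Γ A (λ γ → foldl (λ a x → f (γ , (x , a))) (i γ) (l γ))
comp-foldl-growth {Γ} {X} {A} {f} {i} Inv G inv grows step init xsC =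
  comp-foldl step init xsC (space init ⊞ var ⊠ G) λ γ xs → ≤-trans
    (foldl-growth Γ X A {γ} {f} (Inv γ) G (grows γ) (i γ) (inv γ) xs)
    (+-mono-≤
      (≤-trans (fits init γ) (eval-mono (space init) (m≤m+n _ _)))
      (*-monoˡ-≤ _ (≤-trans (length≤sz X xs) (m≤n+m _ (sz Γ γ)))))

comp-foldr-growth :
  ∀ {f : ⟦ Γ ⟧ × (⟦ X ⟧ × ⟦ A ⟧) → ⟦ A ⟧} {i : ⟦ Γ ⟧ → ⟦ A ⟧} {l : ⟦ Γ ⟧ → List ⟦ X ⟧} (G : Poly) →
  (∀ γ x a → sz A (f (γ , (x , a))) ≤ sz A a + eval G (sz Γ γ + sz X x)) →
  Comp (Γ ⊗ (X ⊗ A)) A f → Comp Γ A i → Comp Γ (list X) l →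
  Comp Γ A (λ γ → foldr (λ x a → f (γ , (x , a))) (i γ) (l γ))
comp-foldr-growth {f = f} {i} {l} G grows step init xsC =
  comp-≗ (λ γ → reverse-foldl (λ a x → f (γ , (x , a))) (i γ) (l γ))
    (comp-foldl-growth (λ _ _ → ⊤) G (λ _ → tt) (λ γ x a _ → tt , grows γ x a)
      step init (comp-reverse xsC))

-- The unary code of a number is also the code of the list of that many zeros. The program is kept
-- unchanged, and folding over this list gives recursion on numbers.
comp-replicate : ∀ {f : ⟦ Γ ⟧ → ℕ} → Comp Γ nat f → Comp Γ (list nat) (λ γ → replicate (f γ) 0)
comp-replicate {Γ} {f} c = record
  { prog  = prog c
  ; time  = time c
  ; space = space c
  ; runs  = λ γ → subst (λ t → prog c ⊢ enc Γ γ ⇓ t within eval (time c) (sz Γ γ)) (unary (f γ)) (runs c γ)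
  ; fits  = λ γ → subst (λ t → size t ≤ eval (space c) (sz Γ γ)) (unary (f γ)) (fits c γ)
  }
  where
  unary : ∀ n → ⌜ n ⌝ℕ ≡ enc (list nat) (replicate n 0)
  unary zero    = refl
  unary (suc n) = cong (nil ∙_) (unary n)

comp-+ : ∀ {f g : ⟦ Γ ⟧ → ℕ} → Comp Γ nat f → Comp Γ nat g → Comp Γ nat (λ γ → f γ + g γ)
comp-+ {f = f} {g} c₁ c₂ = comp-≗ (λ γ → iterate (f γ) (g γ))
  (comp-foldr-growth (con 2) (λ _ _ a → ≤-reflexive (+-comm 2 (sz nat a)))
    (comp-suc (comp-∘ comp-snd comp-snd)) c₂ (comp-replicate c₁))
  where
  iterate : ∀ m n → foldr (λ _ a → suc a) n (replicate m 0) ≡ m + n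
  iterate zero    n = refl
  iterate (suc m) n = cong suc (iterate m n)

comp-∸ : ∀ {f g : ⟦ Γ ⟧ → ℕ} → Comp Γ nat f → Comp Γ nat g → Comp Γ nat (λ γ → f γ ∸ g γ)
comp-∸ {f = f} {g} c₁ c₂ = comp-≗ (λ γ → iterate (f γ) (g γ))
  (comp-foldr-growth (con 0) (λ _ _ a → ≤-trans (size-pred a) (m≤m+n _ 0))
    (comp-pred (comp-∘ comp-snd comp-snd)) c₁ (comp-replicate c₂))
  where
  iterate : ∀ m n → foldr (λ _ a → pred a) m (replicate n 0) ≡ m ∸ n
  iterate m zero    = refl
  iterate m (suc n) = trans (cong pred (iterate m n)) (pred[m∸n]≡m∸[1+n] m n)

if0-⊔ : ∀ m n → if0 (m ∸ n) n m ≡ m ⊔ n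
if0-⊔ zero    n       = cong (λ m → if0 m n 0) (0∸n≡0 n)
if0-⊔ (suc m) zero    = refl
if0-⊔ (suc m) (suc n) = trans (lift (m ∸ n)) (cong suc (if0-⊔ m n))
  where
  lift : ∀ l → if0 l (suc n) (suc m) ≡ suc (if0 l n m)
  lift zero    = refl
  lift (suc l) = refl

comp-⊔ : ∀ {f g : ⟦ Γ ⟧ → ℕ} → Comp Γ nat f → Comp Γ nat g → Comp Γ nat (λ γ → f γ ⊔ g γ)
comp-⊔ {f = f} {g} c₁ c₂ = comp-≗ (λ γ → if0-⊔ (f γ) (g γ)) (comp-if0 (comp-∸ c₁ c₂) c₂ c₁)

if≡ : {C : Set} → ℕ → ℕ → C → C → C
if≡ m n x y = if0 (m ∸ n) (if0 (n ∸ m) x y) y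

comp-if≡ : ∀ {m n : ⟦ Γ ⟧ → ℕ} {f g : ⟦ Γ ⟧ → ⟦ A ⟧} → Comp Γ nat m → Comp Γ nat n →
           Comp Γ A f → Comp Γ A g → Comp Γ A (λ γ → if≡ (m γ) (n γ) (f γ) (g γ))
comp-if≡ c₁ c₂ c₃ c₄ = comp-if0 (comp-∸ c₁ c₂) (comp-if0 (comp-∸ c₂ c₁) c₃ c₄) c₄

comp-length : ∀ {l : ⟦ Γ ⟧ → List ⟦ A ⟧} → Comp Γ (list A) l → Comp Γ nat (λ γ → length (l γ))
comp-length c = comp-foldr-growth (con 2) (λ _ _ a → ≤-reflexive (+-comm 2 (sz nat a)))
  (comp-suc (comp-∘ comp-snd comp-snd)) comp-zero c

comp-map : ∀ {f : ⟦ Γ ⟧ × ⟦ X ⟧ → ⟦ A ⟧} {l : ⟦ Γ ⟧ → List ⟦ X ⟧} →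
           Comp (Γ ⊗ X) A f → Comp Γ (list X) l → Comp Γ (list A) (λ γ → map (λ x → f (γ , x)) (l γ))
comp-map {Γ} {X} {A} {f} {l} c xsC = comp-≗ (λ γ → sym (map-is-foldr (l γ)))
  (comp-foldr-growth (con 1 ⊞ space c ⊙ (con 1 ⊞ var))
    (λ γ x a → ≤-trans (s≤s (+-monoˡ-≤ _ (fits c (γ , x)))) (≤-reflexive (+-comm _ (sz (list A) a))))
    (comp-∷ (comp-∘ c (comp-pair comp-fst (comp-∘ comp-fst comp-snd))) (comp-∘ comp-snd comp-snd))
    comp-[] xsC)

comp-++ : ∀ {l m : ⟦ Γ ⟧ → List ⟦ A ⟧} → Comp Γ (list A) l → Comp Γ (list A) m →
          Comp Γ (list A) (λ γ → l γ ++ m γ)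
comp-++ {Γ} {A} {l} {m} c₁ c₂ = comp-≗ (λ γ → sym (++-is-foldr (l γ) (m γ)))
  (comp-foldr-growth (con 1 ⊞ var)
    (λ γ x a → ≤-trans (≤-reflexive (+-comm (suc (sz A x)) (sz (list A) a)))
      (+-monoʳ-≤ (sz (list A) a) (s≤s (m≤n+m _ (sz Γ γ)))))
    (comp-∷ (comp-∘ comp-fst comp-snd) (comp-∘ comp-snd comp-snd)) c₂ c₁)

sz-+ : ∀ m n → suc (sz nat (m + n)) ≡ sz nat m + sz nat n
sz-+ zero    n = refl
sz-+ (suc m) n = cong (λ s → suc (suc s)) (sz-+ m n)

sumMap : ∀ {C : Set} → (C → ℕ) → List C → ℕ
sumMap f = foldr (λ x a → f x + a) 0

comp-sumMap : ∀ {f : ⟦ Γ ⟧ × ⟦ X ⟧ → ℕ} {l : ⟦ Γ ⟧ → List ⟦ X ⟧} →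
              Comp (Γ ⊗ X) nat f → Comp Γ (list X) l → Comp Γ nat (λ γ → sumMap (λ x → f (γ , x)) (l γ))
comp-sumMap {f = f} c xsC = comp-foldr-growth (space c ⊙ (con 1 ⊞ var))
  (λ γ x a → ≤-trans (n≤1+n _) (≤-trans (≤-reflexive (sz-+ (f (γ , x)) a))
    (≤-trans (+-monoˡ-≤ (sz nat a) (fits c (γ , x))) (≤-reflexive (+-comm _ (sz nat a))))))
  (comp-+ (comp-∘ c (comp-pair comp-fst (comp-∘ comp-fst comp-snd))) (comp-∘ comp-snd comp-snd))
  comp-zero xsC

sz-nat : ∀ n → sz nat n ≡ 1 + 2 * n
sz-nat zero    = refl
sz-nat (suc n) rewrite sz-nat n | +-suc n (n + 0) = refl

≤sz-nat : ∀ n → n ≤ sz nat n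
≤sz-nat n rewrite sz-nat n = m≤n⇒m≤1+n (m≤m+n n _)

sz-list-≤ : ∀ A {m} {xs : List ⟦ A ⟧} → All (λ x → sz A x ≤ m) xs → sz (list A) xs ≤ 1 + length xs * (1 + m)
sz-list-≤ A []           = ≤-refl
sz-list-≤ A {m} (le ∷ p) = s≤s (≤-trans (+-mono-≤ le (sz-list-≤ A p)) (≤-reflexive (+-suc m _)))

sz-elements : ∀ A (xs : List ⟦ A ⟧) → All (λ x → sz A x ≤ sz (list A) xs) xs
sz-elements A []       = []
sz-elements A (x ∷ xs) = m≤n⇒m≤1+n (m≤m+n (sz A x) _) ∷
  All.map (λ le → ≤-trans le (m≤n⇒m≤1+n (m≤n+m _ (sz A x)))) (sz-elements A xs)

-- Longest common subsequences by dynamic programming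

-- A row for x and y has a cell (b , (LCS x (b ∷ y′) , LCS x y′)) for every
-- nonempty suffix b ∷ y′ of y.
Cell Row : Ty
Cell = nat ⊗ (nat ⊗ nat)
Row  = list Cell

corner : ⟦ Row ⟧ → ℕ
corner r = caseList r 0 (λ c _ → proj₁ (proj₂ c))

-- The recurrence for `a ∷ x`, with `r` the finished part of the new row: `v` is LCS x (b ∷ y′),
-- `v′` is LCS x y′ and `corner r` is LCS (a ∷ x) y′. Storing `v′` in the cell makes the diagonal
-- value available without a look at the next old cell.
nextCell : ℕ → ⟦ Cell ⟧ → ⟦ Row ⟧ → ⟦ Cell ⟧
nextCell a (b , (v , v′)) r = b , (if≡ a b (suc v′) (v ⊔ corner r) , corner r)

nextRow : ℕ → ⟦ Row ⟧ → ⟦ Row ⟧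
nextRow a = foldr (λ c r → nextCell a c r ∷ r) []

firstRow : List ℕ → ⟦ Row ⟧
firstRow = map (λ b → b , (0 , 0))

lcsRow : List ℕ → List ℕ → ⟦ Row ⟧
lcsRow x y = foldr nextRow (firstRow y) x

lcsℕ : List ℕ → List ℕ → ℕ
lcsℕ x y = corner (lcsRow x y)

CellBounded : ℕ → ⟦ Cell ⟧ → Set
CellBounded n (b , (v , v′)) = b ≤ n × (v ≤ n × v′ ≤ n)

corner-bounded : ∀ {n r} → All (CellBounded n) r → corner r ≤ n
corner-bounded []      = z≤n
corner-bounded (c ∷ _) = proj₁ (proj₂ c)

if0-≤ : ∀ {m n o} l → m ≤ o → n ≤ o → if0 l m n ≤ o
if0-≤ zero    m≤o n≤o = m≤o
if0-≤ (suc _) m≤o n≤o = n≤o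

-- Only the diagonal value is increased, and only by one. Together with the unchanged length of the
-- row this keeps all rows polynomial over the whole fold.
nextRow-bounded : ∀ a {n r} → All (CellBounded n) r → All (CellBounded (suc n)) (nextRow a r)
nextRow-bounded a [] = []
nextRow-bounded a {n} {(b , (v , v′)) ∷ r} ((b≤n , (v≤n , v′≤n)) ∷ p) =
  (m≤n⇒m≤1+n b≤n , (if0-≤ (a ∸ b) (if0-≤ (b ∸ a) (s≤s v′≤n) v⊔c≤) v⊔c≤ , c≤)) ∷ rest
  where
  rest = nextRow-bounded a p
  c≤   = corner-bounded rest
  v⊔c≤ : v ⊔ corner (nextRow a r) ≤ suc n
  v⊔c≤ = ⊔-lub (m≤n⇒m≤1+n v≤n) c≤

length-nextRow : ∀ a r → length (nextRow a r) ≡ length r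
length-nextRow a []      = refl
length-nextRow a (c ∷ r) = cong suc (length-nextRow a r)

-- Three unary numbers of size at most 1 + 2n, plus two pairing nodes.
sz-cell : ∀ {n} c → CellBounded n c → sz Cell c ≤ 5 + 6 * n
sz-cell {n} (b , (v , v′)) (b≤n , (v≤n , v′≤n)) rewrite sz-nat b | sz-nat v | sz-nat v′ = begin
  suc (1 + 2 * b + suc (1 + 2 * v + (1 + 2 * v′)))   ≡⟨ flatten b v v′ ⟩
  5 + 2 * (b + (v + v′))                             ≤⟨ +-monoʳ-≤ 5 (*-monoʳ-≤ 2 (+-mono-≤ b≤n (+-mono-≤ v≤n v′≤n))) ⟩
  5 + 2 * (n + (n + n))                              ≡⟨ collect n ⟩
  5 + 6 * n                                          ∎
  where
  open ≤-Reasoning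
  flatten : ∀ a b c → suc (1 + 2 * a + suc (1 + 2 * b + (1 + 2 * c))) ≡ 5 + 2 * (a + (b + c))
  flatten = solve-∀
  collect : ∀ n → 5 + 2 * (n + (n + n)) ≡ 5 + 6 * n
  collect = solve-∀

sz-row : ∀ {n} r → All (CellBounded n) r → sz Row r ≤ 1 + length r * (6 + 6 * n)
sz-row r p = sz-list-≤ Cell (All.map (λ {c} → sz-cell c) p)

row-bounded : ∀ r → All (CellBounded (sz Row r)) r
row-bounded r = All.map (λ {c} → cell c) (sz-elements Cell r)
  where
  cell : ∀ c → sz Cell c ≤ sz Row r → CellBounded (sz Row r) c
  cell (b , (v , v′)) le =
      ≤-trans (≤sz-nat b) (≤-trans (m≤n⇒m≤1+n (m≤m+n _ _)) le)
    , ( ≤-trans (≤sz-nat v) (≤-trans (m≤n⇒m≤1+n (≤-trans (m≤n⇒m≤1+n (m≤m+n _ _)) (m≤n+m _ (sz nat b)))) le)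
      , ≤-trans (≤sz-nat v′) (≤-trans (m≤n⇒m≤1+n (≤-trans (m≤n⇒m≤1+n (m≤n+m _ (sz nat v))) (m≤n+m _ (sz nat b)))) le))

-- The size of a row with at most N cells and entries up to N + 1, where N is the argument; the
-- leading 6 is the 5 of a cell plus its list node.
rowSpace : Poly
rowSpace = con 1 ⊞ var ⊠ (con 6 ⊞ con 6 ⊠ (con 1 ⊞ var))

comp-nextRow : Comp (nat ⊗ Row) Row (λ γ → nextRow (proj₁ γ) (proj₂ γ))
comp-nextRow = comp-foldr
  (comp-∷
    (comp-pair b (comp-pair (comp-if≡ a b (comp-suc v′) (comp-⊔ v c)) c))
    r)
  comp-[] comp-snd rowSpace
  λ { γ@(a , _) r → ≤-trans (sz-row (nextRow a r) (nextRow-bounded a (row-bounded r)))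
      (s≤s (*-mono-≤
        (≤-trans (≤-reflexive (length-nextRow a r)) (≤-trans (length≤sz Cell r) (m≤n+m _ (sz (nat ⊗ Row) γ))))
        (+-monoʳ-≤ 6 (*-monoʳ-≤ 6 (s≤s (m≤n+m _ (sz (nat ⊗ Row) γ))))))) }
  where
  Env = (nat ⊗ Row) ⊗ (Cell ⊗ Row)
  a : Comp Env nat (λ γ → proj₁ (proj₁ γ))
  a = comp-∘ comp-fst comp-fst
  cell : Comp Env Cell (λ γ → proj₁ (proj₂ γ))
  cell = comp-∘ comp-fst comp-snd
  r : Comp Env Row (λ γ → proj₂ (proj₂ γ))
  r = comp-∘ comp-snd comp-snd
  b  = comp-∘ comp-fst cell
  v  = comp-∘ comp-fst (comp-∘ comp-snd cell)
  v′ = comp-∘ comp-snd (comp-∘ comp-snd cell)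
  c : Comp Env nat (λ γ → corner (proj₂ (proj₂ γ)))
  c = comp-case r comp-zero (comp-∘ comp-fst (comp-∘ comp-snd (comp-∘ comp-fst comp-snd)))

firstRow-bounded : ∀ y → All (CellBounded (sz (list nat) y)) (firstRow y)
firstRow-bounded y = All.map⁺ (All.map (λ {b} le → ≤-trans (≤sz-nat b) le , (z≤n , z≤n)) (sz-elements nat y))

lcsRow-bounded : ∀ x y → All (CellBounded (length x + sz (list nat) y)) (lcsRow x y)
lcsRow-bounded []      y = firstRow-bounded y
lcsRow-bounded (a ∷ x) y = nextRow-bounded a (lcsRow-bounded x y)

length-lcsRow : ∀ x y → length (lcsRow x y) ≡ length y
length-lcsRow []      y = length-map _ y
length-lcsRow (a ∷ x) y = trans (length-nextRow a (lcsRow x y)) (length-lcsRow x y)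

comp-lcsℕ : ∀ {f g : ⟦ Γ ⟧ → List ℕ} → Comp Γ (list nat) f → Comp Γ (list nat) g →
            Comp Γ nat (λ γ → lcsℕ (f γ) (g γ))
comp-lcsℕ c₁ c₂ = comp-∘ base (comp-pair c₁ c₂)
  where
  Env = list nat ⊗ list nat
  row : Comp Env Row (λ γ → lcsRow (proj₁ γ) (proj₂ γ))
  row = comp-foldr (comp-∘ comp-nextRow comp-snd)
    (comp-map (comp-pair comp-snd (comp-pair comp-zero comp-zero)) comp-snd) comp-fst rowSpace
    λ { γ@(_ , y) x → ≤-trans (sz-row (lcsRow x y) (lcsRow-bounded x y))
        (s≤s (*-mono-≤
          (≤-trans (≤-reflexive (length-lcsRow x y)) (≤-trans (length≤sz nat y) (≤-trans (y≤ γ) (m≤m+n _ _))))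
          (+-monoʳ-≤ 6 (*-monoʳ-≤ 6 (m≤n⇒m≤1+n (≤-trans (+-mono-≤ (length≤sz nat x) (y≤ γ))
            (≤-reflexive (+-comm _ (sz Env γ))))))))) }
    where
    y≤ : ∀ γ → sz (list nat) (proj₂ γ) ≤ sz Env γ
    y≤ γ = m≤n⇒m≤1+n (m≤n+m _ _)
  base : Comp Env nat (λ γ → lcsℕ (proj₁ γ) (proj₂ γ))
  base = comp-case row comp-zero (comp-∘ comp-fst (comp-∘ comp-snd (comp-∘ comp-fst comp-snd)))

-- The reduction as list programs

-- Each word shifts all later ones by its own length, so in a family of permutations of `Fin d` the
-- i-th word is shifted by i * d, into the i-th copy of the alphabet.
embedℕ : List (List ℕ) → List ℕ
embedℕ = foldr (λ r w → r ++ map (length r +_) w) []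

embedℕ-bounded : ∀ rs → All (_≤ sz (list (list nat)) rs) (embedℕ rs)
embedℕ-bounded []       = []
embedℕ-bounded (r ∷ rs) = All.++⁺
  (All.map (λ {a} le → m≤n⇒m≤1+n (≤-trans (≤-trans (≤sz-nat a) le) (m≤m+n _ _))) (sz-elements nat r))
  (All.map⁺ (All.map (λ le → m≤n⇒m≤1+n (+-mono-≤ (length≤sz nat r) le)) (embedℕ-bounded rs)))

length-embedℕ : ∀ rs → length (embedℕ rs) ≤ sz (list (list nat)) rs
length-embedℕ []       = z≤n
length-embedℕ (r ∷ rs) = begin
  length (r ++ map (length r +_) (embedℕ rs))            ≡⟨ length-++ r ⟩
  length r + length (map (length r +_) (embedℕ rs))      ≡⟨ cong (length r +_) (length-map _ (embedℕ rs)) ⟩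
  length r + length (embedℕ rs)                          ≤⟨ +-mono-≤ (length≤sz nat r) (length-embedℕ rs) ⟩
  sz (list nat) r + sz (list (list nat)) rs              ≤⟨ n≤1+n _ ⟩
  suc (sz (list nat) r + sz (list (list nat)) rs)        ∎
  where open ≤-Reasoning

comp-embedℕ : Comp (list (list nat)) (list nat) embedℕ
comp-embedℕ = comp-foldr
  (comp-++ r (comp-map (comp-+ (comp-∘ (comp-length r) comp-fst) comp-snd) (comp-∘ comp-snd comp-snd)))
  comp-[] comp-id (con 1 ⊞ var ⊠ (con 1 ⊞ (con 1 ⊞ con 2 ⊠ var)))
  λ γ rs → let rs≤ = m≤n+m (sz (list (list nat)) rs) (sz (list (list nat)) γ) in ≤-trans
    (sz-list-≤ nat (All.map (λ {a} le → ≤-trans (≤-reflexive (sz-nat a)) (s≤s (*-monoʳ-≤ 2 le))) (embedℕ-bounded rs)))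
    (s≤s (*-mono-≤ (≤-trans (length-embedℕ rs) rs≤) (+-monoʳ-≤ 2 (*-monoʳ-≤ 2 rs≤))))
  where
  r : Comp (list (list nat) ⊗ (list nat ⊗ list nat)) (list nat) (λ γ → proj₁ (proj₂ γ))
  r = comp-∘ comp-fst comp-snd

rotate : {C : Set} → List C → List C
rotate xs = caseList xs [] (λ x xs → xs ++ x ∷ [])

sz-rotate : ∀ A (xs : List ⟦ A ⟧) → sz (list A) (rotate xs) ≡ sz (list A) xs
sz-rotate A []       = refl
sz-rotate A (x ∷ xs) = suc-injective (trans (sz-++ A xs (x ∷ [])) (rearrange (sz (list A) xs) (sz A x)))
  where
  rearrange : ∀ m n → m + suc (n + 1) ≡ suc (suc (n + m))
  rearrange = solve-∀

rotationStep : List (List ℕ) × List (List ℕ) → List (List ℕ) × List (List ℕ)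
rotationStep (rs , ws) = rotate rs , embedℕ rs ∷ ws

-- The fold goes through `rs` only to count k rounds. Round j puts the embedding of the j-th
-- rotation in front of the earlier ones, whence the final reversal.
centerℕ : List (List ℕ) → List (List ℕ)
centerℕ rs = reverse (proj₂ (foldl (λ s _ → rotationStep s) (rs , []) rs))

comp-centerℕ : Comp (list (list nat)) (list (list nat)) centerℕ
comp-centerℕ = comp-reverse (comp-∘ comp-snd (comp-foldl-growth
  -- A rotation is no larger than the input, so the word emitted in a round is bounded in terms of
  -- the input alone.
  (λ γ s → sz Words (proj₁ s) ≤ sz Words γ)
  (con 1 ⊞ space comp-embedℕ)
  (λ γ → ≤-refl)
  (λ γ x s inv → ≤-trans (≤-reflexive (sz-rotate (list nat) (proj₁ s))) inv , grows γ x s inv)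
  (comp-pair
    (comp-case rs comp-[] (comp-++ (comp-∘ comp-snd comp-snd) (comp-∷ (comp-∘ comp-fst comp-snd) comp-[])))
    (comp-∷ (comp-∘ comp-embedℕ rs) (comp-∘ comp-snd (comp-∘ comp-snd comp-snd))))
  (comp-pair comp-id comp-[]) comp-id))
  where
  Words = list (list nat)
  rs : Comp (Words ⊗ (list nat ⊗ (Words ⊗ Words))) Words (λ γ → proj₁ (proj₂ (proj₂ γ)))
  rs = comp-∘ comp-fst (comp-∘ comp-snd comp-snd)
  grows : ∀ γ (x : List ℕ) s → sz Words (proj₁ s) ≤ sz Words γ →
          sz (Words ⊗ Words) (rotationStep s) ≤
          sz (Words ⊗ Words) s + (1 + eval (space comp-embedℕ) (sz Words γ + sz (list nat) x))
  grows γ x (rs , ws) inv = begin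
    suc (sz Words (rotate rs) + suc (sz (list nat) (embedℕ rs) + sz Words ws))
      ≡⟨ cong (λ m → suc (m + suc (sz (list nat) (embedℕ rs) + sz Words ws))) (sz-rotate (list nat) rs) ⟩
    suc (sz Words rs + suc (sz (list nat) (embedℕ rs) + sz Words ws))
      ≡⟨ rearrange (sz Words rs) (sz (list nat) (embedℕ rs)) (sz Words ws) ⟩
    suc (sz Words rs + sz Words ws) + (1 + sz (list nat) (embedℕ rs))
      ≤⟨ +-monoʳ-≤ (suc (sz Words rs + sz Words ws)) (s≤s (≤-trans (fits comp-embedℕ rs)
           (eval-mono (space comp-embedℕ) (≤-trans inv (m≤m+n _ _))))) ⟩
    suc (sz Words rs + sz Words ws) + (1 + eval (space comp-embedℕ) (sz Words γ + sz (list nat) x)) ∎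
    where
    open ≤-Reasoning
    rearrange : ∀ a b c → suc (a + suc (b + c)) ≡ suc (a + c) + (1 + b)
    rearrange = solve-∀

-- `length w` stands in for `d`, which the codes do not contain explicitly.
costℕ : List (List ℕ) → List ℕ → ℕ
costℕ rs w = sumMap (λ r → length w ∸ lcsℕ w r) rs

comp-costℕ : ∀ {f : ⟦ Γ ⟧ → List (List ℕ)} {g : ⟦ Γ ⟧ → List ℕ} → Comp Γ (list (list nat)) f →
             Comp Γ (list nat) g → Comp Γ nat (λ γ → costℕ (f γ) (g γ))
comp-costℕ c₁ c₂ = comp-∘
  (comp-sumMap (comp-∸ (comp-length w) (comp-lcsℕ w comp-snd)) comp-fst) (comp-pair c₁ c₂)
  where
  w : Comp ((list (list nat) ⊗ list nat) ⊗ list nat) (list nat) (λ γ → proj₂ (proj₁ γ))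
  w = comp-∘ comp-snd comp-fst

-- `suc a ∸ n` is zero exactly when a < n, that is, when the symbol lies in the first copy.
lowℕ highℕ : ℕ → List ℕ → List ℕ
lowℕ  n = foldr (λ a w → if0 (suc a ∸ n) (a ∷ w) w) []
highℕ n = foldr (λ a w → if0 (suc a ∸ n) w (a ∸ n ∷ w)) []

sz-∸ : ∀ m n → sz nat (m ∸ n) ≤ sz nat m
sz-∸ m n rewrite sz-nat (m ∸ n) | sz-nat m = s≤s (*-monoʳ-≤ 2 (m∸n≤m m n))

sz-lowℕ-step : ∀ n a w → sz (list nat) (if0 (suc a ∸ n) (a ∷ w) w) ≤ suc (sz nat a + sz (list nat) w)
sz-lowℕ-step n a w with suc a ∸ n
... | zero  = ≤-refl
... | suc _ = m≤n⇒m≤1+n (m≤n+m _ (sz nat a))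

sz-highℕ-step : ∀ n a w → sz (list nat) (if0 (suc a ∸ n) w (a ∸ n ∷ w)) ≤ suc (sz nat a + sz (list nat) w)
sz-highℕ-step n a w with suc a ∸ n
... | zero  = m≤n⇒m≤1+n (m≤n+m _ (sz nat a))
... | suc _ = s≤s (+-monoˡ-≤ _ (sz-∸ a n))

sz-lowℕ : ∀ n w → sz (list nat) (lowℕ n w) ≤ sz (list nat) w
sz-lowℕ n []      = ≤-refl
sz-lowℕ n (a ∷ w) = ≤-trans (sz-lowℕ-step n a (lowℕ n w)) (s≤s (+-monoʳ-≤ (sz nat a) (sz-lowℕ n w)))

sz-highℕ : ∀ n w → sz (list nat) (highℕ n w) ≤ sz (list nat) w
sz-highℕ n []      = ≤-refl
sz-highℕ n (a ∷ w) = ≤-trans (sz-highℕ-step n a (highℕ n w)) (s≤s (+-monoʳ-≤ (sz nat a) (sz-highℕ n w)))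

comp-lowℕ : Comp (nat ⊗ list nat) (list nat) (λ γ → lowℕ (proj₁ γ) (proj₂ γ))
comp-lowℕ = comp-foldr
  (comp-if0 (comp-∸ (comp-suc a) (comp-∘ comp-fst comp-fst)) (comp-∷ a w) w)
  comp-[] comp-snd var
  λ { (n , v) w → ≤-trans (sz-lowℕ n w) (m≤n+m _ (sz (nat ⊗ list nat) (n , v))) }
  where
  a : Comp ((nat ⊗ list nat) ⊗ (nat ⊗ list nat)) nat (λ γ → proj₁ (proj₂ γ))
  a = comp-∘ comp-fst comp-snd
  w : Comp ((nat ⊗ list nat) ⊗ (nat ⊗ list nat)) (list nat) (λ γ → proj₂ (proj₂ γ))
  w = comp-∘ comp-snd comp-snd

comp-highℕ : Comp (nat ⊗ list nat) (list nat) (λ γ → highℕ (proj₁ γ) (proj₂ γ))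
comp-highℕ = comp-foldr
  (comp-if0 (comp-∸ (comp-suc a) n) w (comp-∷ (comp-∸ a n) w))
  comp-[] comp-snd var
  λ { (n , v) w → ≤-trans (sz-highℕ n w) (m≤n+m _ (sz (nat ⊗ list nat) (n , v))) }
  where
  n : Comp ((nat ⊗ list nat) ⊗ (nat ⊗ list nat)) nat (λ γ → proj₁ (proj₁ γ))
  n = comp-∘ comp-fst comp-fst
  a : Comp ((nat ⊗ list nat) ⊗ (nat ⊗ list nat)) nat (λ γ → proj₁ (proj₂ γ))
  a = comp-∘ comp-fst comp-snd
  w : Comp ((nat ⊗ list nat) ⊗ (nat ⊗ list nat)) (list nat) (λ γ → proj₂ (proj₂ γ))
  w = comp-∘ comp-snd comp-snd

argmin : {C : Set} → (C → ℕ) → C → C → C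
argmin f x y = if0 (f x ∸ f y) x y

firstWord : List (List ℕ) → List ℕ
firstWord rs = caseList rs [] (λ r _ → r)

recoverStep : List (List ℕ) → List ℕ × List ℕ → List ℕ × List ℕ
recoverStep rs (t , w) =
  highℕ (length (firstWord rs)) t , argmin (costℕ rs) w (lowℕ (length (firstWord rs)) t)

-- The state holds the uninspected rest of the center and the cheapest word so far. Again `rs`
-- drives the fold as a counter, one round per block.
recoverℕ : List (List ℕ) × List ℕ → List ℕ
recoverℕ (rs , t) = proj₂ (foldl (λ s _ → recoverStep rs s) (t , firstWord rs) rs)

comp-recoverℕ : Comp (list (list nat) ⊗ list nat) (list nat) recoverℕ
comp-recoverℕ = comp-∘ comp-snd (comp-foldl-growth
  -- The rest never exceeds the input, hence neither does the next block. The chosen word is bounded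
  -- by the sum of both candidates, which keeps the growth additive.
  (λ γ s → sz Word (proj₁ s) ≤ sz Env γ) var
  (λ γ → m≤n⇒m≤1+n (m≤n+m _ _))
  (λ γ r s inv → ≤-trans (sz-highℕ (length (firstWord (proj₁ γ))) (proj₁ s)) inv , grows γ r s inv)
  (comp-pair (comp-∘ comp-highℕ (comp-pair n t))
    (comp-if0 (comp-∸ (comp-costℕ rs w) (comp-costℕ rs c)) w c))
  (comp-pair comp-snd first) comp-fst)
  where
  Word = list nat
  Env  = list Word ⊗ Word
  Step = Env ⊗ (Word ⊗ (Word ⊗ Word))
  first : Comp Env Word (λ γ → firstWord (proj₁ γ))
  first = comp-case comp-fst comp-[] (comp-∘ comp-fst comp-snd)
  rs : Comp Step (list Word) (λ γ → proj₁ (proj₁ γ))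
  rs = comp-∘ comp-fst comp-fst
  n : Comp Step nat (λ γ → length (firstWord (proj₁ (proj₁ γ))))
  n = comp-length (comp-∘ first comp-fst)
  t : Comp Step Word (λ γ → proj₁ (proj₂ (proj₂ γ)))
  t = comp-∘ comp-fst (comp-∘ comp-snd comp-snd)
  w : Comp Step Word (λ γ → proj₂ (proj₂ (proj₂ γ)))
  w = comp-∘ comp-snd (comp-∘ comp-snd comp-snd)
  c : Comp Step Word (λ γ → lowℕ (length (firstWord (proj₁ (proj₁ γ)))) (proj₁ (proj₂ (proj₂ γ))))
  c = comp-∘ comp-lowℕ (comp-pair n t)
  sz-if0 : ∀ m (v w : List ℕ) → sz Word (if0 m v w) ≤ sz Word v + sz Word w
  sz-if0 zero    v w = m≤m+n _ _
  sz-if0 (suc _) v w = m≤n+m _ _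
  grows : ∀ γ (r : List ℕ) s → sz Word (proj₁ s) ≤ sz Env γ →
          sz (Word ⊗ Word) (recoverStep (proj₁ γ) s) ≤ sz (Word ⊗ Word) s + (sz Env γ + sz Word r)
  grows γ r (t , w) inv = s≤s (begin
    sz Word (highℕ m t) + sz Word (argmin (costℕ (proj₁ γ)) w (lowℕ m t))
      ≤⟨ +-mono-≤ (sz-highℕ m t) (≤-trans (sz-if0 (costℕ (proj₁ γ) w ∸ costℕ (proj₁ γ) (lowℕ m t)) w (lowℕ m t)) (+-monoʳ-≤ (sz Word w) (≤-trans (sz-lowℕ m t) inv))) ⟩
    sz Word t + (sz Word w + sz Env γ)
      ≡⟨ +-assoc (sz Word t) (sz Word w) _ ⟨
    sz Word t + sz Word w + sz Env γ
      ≤⟨ +-monoʳ-≤ (sz Word t + sz Word w) (m≤m+n _ _) ⟩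
    sz Word t + sz Word w + (sz Env γ + sz Word r) ∎)
    where
    open ≤-Reasoning
    m = length (firstWord (proj₁ γ))

-- Two duplicate-free lists with the same members are permutations of each other; here the second
-- one is `allFin n`.
length-word : ∀ {n} (σ : 𝒫 n) → length (word σ) ≡ n
length-word {n} σ = trans (↭-length (∼bag⇒↭ (unique∧set⇒bag (proj₂ (isPermutation σ)) (Unique.allFin⁺ n)
  (mk⇔ (λ _ → ∈-allFin _) (λ _ → proj₁ (isPermutation σ) _))))) (length-tabulate {n = n} (λ i → i))

-- Concatenation of alphabets

private variable
  m n : ℕ

join : List (Fin m) → List (Fin n) → List (Fin (m + n))
join {m} {n} x y = map (_↑ˡ n) x ++ map (m ↑ʳ_) y

low : ∀ m → List (Fin (m + n)) → List (Fin m)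
low m = mapMaybe (λ a → isInj₁ (splitAt m a))

high : ∀ m → List (Fin (m + n)) → List (Fin n)
high m = mapMaybe (λ a → isInj₂ (splitAt m a))

low-join : (x : List (Fin m)) (y : List (Fin n)) → low m (join x y) ≡ x
low-join {m} {n} x y = begin
  low m (map (_↑ˡ n) x ++ map (m ↑ʳ_) y)              ≡⟨ mapMaybe-++ _ (map (_↑ˡ n) x) _ ⟩
  low m (map (_↑ˡ n) x) ++ low m (map (m ↑ʳ_) y)      ≡⟨ cong₂ _++_
    (mapMaybe-map-retract (λ i → cong isInj₁ (splitAt-↑ˡ m i n)) x)
    (mapMaybe-map-none (λ i → cong isInj₁ (splitAt-↑ʳ m n i)) y) ⟩
  x ++ []                                             ≡⟨ ++-identityʳ x ⟩
  x                                                   ∎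
  where open ≡-Reasoning

high-join : (x : List (Fin m)) (y : List (Fin n)) → high m (join x y) ≡ y
high-join {m} {n} x y = begin
  high m (map (_↑ˡ n) x ++ map (m ↑ʳ_) y)             ≡⟨ mapMaybe-++ _ (map (_↑ˡ n) x) _ ⟩
  high m (map (_↑ˡ n) x) ++ high m (map (m ↑ʳ_) y)    ≡⟨ cong₂ _++_
    (mapMaybe-map-none (λ i → cong isInj₂ (splitAt-↑ˡ m i n)) x)
    (mapMaybe-map-retract (λ i → cong isInj₂ (splitAt-↑ʳ m n i)) y) ⟩
  y                                                   ∎
  where open ≡-Reasoning

length-low-high : ∀ m (w : List (Fin (m + n))) → length w ≡ length (low m w) + length (high m w)
length-low-high m []      = refl
length-low-high m (a ∷ w) with splitAt m a
... | inj₁ _ = cong suc (length-low-high m w)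
... | inj₂ _ = trans (cong suc (length-low-high m w)) (sym (+-suc (length (low m w)) _))

module _ {A B : Set} (f : A → Maybe B) where

  mapMaybe-⊆ : ∀ {v w} → v ⊆ w → mapMaybe f v ⊆ mapMaybe f w
  mapMaybe-⊆ [] = []
  mapMaybe-⊆ (a ∷ʳ p) with f a
  ... | just b  = b ∷ʳ mapMaybe-⊆ p
  ... | nothing = mapMaybe-⊆ p
  mapMaybe-⊆ {a ∷ _} (refl ∷ p) with f a
  ... | just b  = refl ∷ mapMaybe-⊆ p
  ... | nothing = mapMaybe-⊆ p

  ∈-mapMaybe⁺ : ∀ {a b w} → a ∈ w → f a ≡ just b → b ∈ mapMaybe f w
  ∈-mapMaybe⁺ {a} (here refl) eq with f a
  ∈-mapMaybe⁺ (here refl) refl | just b = here refl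
  ∈-mapMaybe⁺ {w = c ∷ _} (there i) eq with f c
  ... | just _  = there (∈-mapMaybe⁺ i eq)
  ... | nothing = ∈-mapMaybe⁺ i eq

  All-mapMaybe⁺ : ∀ {P : A → Set} {Q : B → Set} → (∀ {a b} → f a ≡ just b → P a → Q b) →
                  ∀ {w} → All P w → All Q (mapMaybe f w)
  All-mapMaybe⁺ h [] = []
  All-mapMaybe⁺ h {a ∷ _} (p ∷ ps) with f a in eq
  ... | just b  = h eq p ∷ All-mapMaybe⁺ h ps
  ... | nothing = All-mapMaybe⁺ h ps

  mapMaybe-unique : (∀ {a a′ b} → f a ≡ just b → f a′ ≡ just b → a ≡ a′) →
                    ∀ {w} → Unique w → Unique (mapMaybe f w)
  mapMaybe-unique inj [] = []
  mapMaybe-unique inj {a ∷ _} (a∉ ∷ u) with f a in eq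
  ... | just b  = All-mapMaybe⁺ (λ eq′ a≢a′ b≡b′ → a≢a′ (inj eq (trans eq′ (cong just (sym b≡b′))))) a∉
                  ∷ mapMaybe-unique inj u
  ... | nothing = mapMaybe-unique inj u

low-inverse : ∀ m {a : Fin (m + n)} {i} → isInj₁ (splitAt m a) ≡ just i → i ↑ˡ n ≡ a
low-inverse m {a} eq with splitAt m a in split
low-inverse m refl | inj₁ i = splitAt⁻¹-↑ˡ split

high-inverse : ∀ m {a : Fin (m + n)} {i} → isInj₂ (splitAt m a) ≡ just i → m ↑ʳ i ≡ a
high-inverse m {a} eq with splitAt m a in split
high-inverse m refl | inj₂ i = splitAt⁻¹-↑ʳ split

low𝒫 : ∀ m → 𝒫 (m + n) → 𝒫 m
low𝒫 {n} m (w , (complete , unique)) = low m w ,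
  ( (λ i → ∈-mapMaybe⁺ _ (complete (i ↑ˡ n)) (cong isInj₁ (splitAt-↑ˡ m i n)))
  , mapMaybe-unique _ (λ e e′ → trans (sym (low-inverse m e)) (low-inverse m e′)) unique )

high𝒫 : ∀ m → 𝒫 (m + n) → 𝒫 n
high𝒫 {n} m (w , (complete , unique)) = high m w ,
  ( (λ i → ∈-mapMaybe⁺ _ (complete (m ↑ʳ i)) (cong isInj₂ (splitAt-↑ʳ m n i)))
  , mapMaybe-unique _ (λ e e′ → trans (sym (high-inverse m e)) (high-inverse m e′)) unique )

join𝒫 : 𝒫 m → 𝒫 n → 𝒫 (m + n)
join𝒫 {m} {n} (x , (x-complete , x-unique)) (y , (y-complete , y-unique)) =
  join x y , (complete , Unique.++⁺ (Unique.map⁺ (Fin.↑ˡ-injective n _ _) x-unique)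
                                    (Unique.map⁺ (Fin.↑ʳ-injective m _ _) y-unique) disjoint)
  where
  complete : ∀ a → a ∈ join x y
  complete a with splitAt m a in split
  ... | inj₁ i = subst (_∈ join x y) (splitAt⁻¹-↑ˡ split) (∈-++⁺ˡ (∈-map⁺ (_↑ˡ n) (x-complete i)))
  ... | inj₂ i = subst (_∈ join x y) (splitAt⁻¹-↑ʳ split) (∈-++⁺ʳ (map (_↑ˡ n) x) (∈-map⁺ (m ↑ʳ_) (y-complete i)))
  disjoint : Disjoint (map (_↑ˡ n) x) (map (m ↑ʳ_) y)
  disjoint (p , q) with ∈-map⁻ (_↑ˡ n) p | ∈-map⁻ (m ↑ʳ_) q
  ... | i , (_ , refl) | j , (_ , eq)
    with () ← trans (sym (splitAt-↑ˡ m i n)) (trans (cong (splitAt m) eq) (splitAt-↑ʳ m n j))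

-- Longest common subsequences and Ulam distances over concatenated alphabets

LCS-≥ : ∀ {x y z : List (Fin n)} → z ⊆ x → z ⊆ y → length z ≤ LCS x y
LCS-≥ {x = x} {y} p q = proj₂ (LCS-isLCS x y) _ p q

LCS-witness : (x y : List (Fin n)) → ∃[ z ] z ⊆ x × z ⊆ y × length z ≡ LCS x y
LCS-witness x y = proj₁ (LCS-isLCS x y)

LCS-≤-length : (x y : List (Fin n)) → LCS x y ≤ length x
LCS-≤-length x y with LCS-witness x y
... | z , z⊆x , _ , eq = subst (_≤ length x) eq (length-mono-≤ z⊆x)

LCS-join-≥ : (x x′ : List (Fin m)) (y y′ : List (Fin n)) → LCS x x′ + LCS y y′ ≤ LCS (join x y) (join x′ y′)
LCS-join-≥ {m} {n} x x′ y y′ with LCS-witness x x′ | LCS-witness y y′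
... | z , p , p′ , e | v , q , q′ , f = subst (_≤ LCS (join x y) (join x′ y′)) length-join
  (LCS-≥ (⊆-++⁺ (⊆-map⁺ (_↑ˡ n) p) (⊆-map⁺ (m ↑ʳ_) q)) (⊆-++⁺ (⊆-map⁺ (_↑ˡ n) p′) (⊆-map⁺ (m ↑ʳ_) q′)))
  where
  length-join : length (join z v) ≡ LCS x x′ + LCS y y′
  length-join = trans (length-++ (map (_↑ˡ n) z))
    (cong₂ _+_ (trans (length-map _ z) e) (trans (length-map _ v) f))

-- Every symbol of a common subsequence lies in exactly one of the two alphabets. Filtering by
-- alphabet preserves subsequences and takes `join x y` back to `x` and to `y`, so a witness splits
-- into two common subsequences.
LCS-join-≤ : (w : List (Fin (m + n))) (x : List (Fin m)) (y : List (Fin n)) →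
             LCS w (join x y) ≤ LCS (low m w) x + LCS (high m w) y
LCS-join-≤ {m} w x y with LCS-witness w (join x y)
... | z , p , q , e = begin
  LCS w (join x y)                         ≡⟨ e ⟨
  length z                                 ≡⟨ length-low-high m z ⟩
  length (low m z) + length (high m z)     ≤⟨ +-mono-≤
    (LCS-≥ (mapMaybe-⊆ _ p) (subst (low m z ⊆_) (low-join x y) (mapMaybe-⊆ _ q)))
    (LCS-≥ (mapMaybe-⊆ _ p) (subst (high m z ⊆_) (high-join x y) (mapMaybe-⊆ _ q))) ⟩
  LCS (low m w) x + LCS (high m w) y       ∎
  where open ≤-Reasoning

∸-+-≤ : ∀ m n a b {l} → a + b ≤ l → (m + n) ∸ l ≤ (m ∸ a) + (n ∸ b)
∸-+-≤ m n a b {l} a+b≤l = m≤n+o⇒m∸n≤o (m + n) l (begin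
  m + n                            ≤⟨ +-mono-≤ (m≤n+m∸n m a) (m≤n+m∸n n b) ⟩
  a + (m ∸ a) + (b + (n ∸ b))      ≡⟨ rearrange a (m ∸ a) b (n ∸ b) ⟩
  a + b + ((m ∸ a) + (n ∸ b))      ≤⟨ +-monoˡ-≤ _ a+b≤l ⟩
  l + ((m ∸ a) + (n ∸ b))          ∎)
  where
  open ≤-Reasoning
  rearrange : ∀ a b c d → a + b + (c + d) ≡ a + c + (b + d)
  rearrange = solve-∀

-- `a ≤ m` and `b ≤ n` rule out truncation on the left; otherwise the excess of one block would be
-- deducted from the distance of the other on the right.
+-∸-≤ : ∀ {m n a b l} → a ≤ m → b ≤ n → l ≤ a + b → (m ∸ a) + (n ∸ b) ≤ (m + n) ∸ l
+-∸-≤ {m} {n} {a} {b} {l} a≤m b≤n l≤a+b = begin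
  (m ∸ a) + (n ∸ b)                           ≡⟨ m+n∸n≡m _ (a + b) ⟨
  (m ∸ a) + (n ∸ b) + (a + b) ∸ (a + b)       ≡⟨ cong (_∸ (a + b)) (rearrange (m ∸ a) a (n ∸ b) b) ⟩
  (m ∸ a) + a + ((n ∸ b) + b) ∸ (a + b)       ≡⟨ cong (_∸ (a + b)) (cong₂ _+_ (m∸n+n≡m a≤m) (m∸n+n≡m b≤n)) ⟩
  (m + n) ∸ (a + b)                           ≤⟨ ∸-monoʳ-≤ (m + n) l≤a+b ⟩
  (m + n) ∸ l                                 ∎
  where
  open ≤-Reasoning
  rearrange : ∀ a b c d → a + c + (b + d) ≡ a + b + (c + d)
  rearrange = solve-∀

𝒰-join-≤ : (σ σ′ : 𝒫 m) (τ τ′ : 𝒫 n) → 𝒰 (join𝒫 σ τ) (join𝒫 σ′ τ′) ≤ 𝒰 σ σ′ + 𝒰 τ τ′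
𝒰-join-≤ {m} {n} σ σ′ τ τ′ = ∸-+-≤ m n (LCS (word σ) (word σ′)) (LCS (word τ) (word τ′)) (LCS-join-≥ (word σ) (word σ′) (word τ) (word τ′))

𝒰-join-≥ : (ρ : 𝒫 (m + n)) (σ : 𝒫 m) (τ : 𝒫 n) → 𝒰 (low𝒫 m ρ) σ + 𝒰 (high𝒫 m ρ) τ ≤ 𝒰 ρ (join𝒫 σ τ)
𝒰-join-≥ {m} ρ σ τ = +-∸-≤ (bound (low𝒫 m ρ) σ) (bound (high𝒫 m ρ) τ) (LCS-join-≤ (word ρ) (word σ) (word τ))
  where
  bound : ∀ {n} (σ τ : 𝒫 n) → LCS (word σ) (word τ) ≤ n
  bound σ τ = subst (LCS (word σ) (word τ) ≤_) (length-word σ) (LCS-≤-length (word σ) (word τ))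

-- Sums over initial segments of ℕ

sumTo : ℕ → (ℕ → ℕ) → ℕ
sumTo n f = sum (applyUpTo f n)

applyUpTo-cong : ∀ {C : Set} {f g : ℕ → C} → (∀ i → f i ≡ g i) → ∀ n → applyUpTo f n ≡ applyUpTo g n
applyUpTo-cong eq zero    = refl
applyUpTo-cong eq (suc n) = cong₂ _∷_ (eq 0) (applyUpTo-cong (λ i → eq (suc i)) n)

tabulate-toℕ : ∀ {C : Set} (f : ℕ → C) n → tabulate {n = n} (λ i → f (toℕ i)) ≡ applyUpTo f n
tabulate-toℕ f zero    = refl
tabulate-toℕ f (suc n) = cong (f 0 ∷_) (tabulate-toℕ (λ i → f (suc i)) n)

sumTo-mono : ∀ n {f g : ℕ → ℕ} → (∀ i → f i ≤ g i) → sumTo n f ≤ sumTo n g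
sumTo-mono zero    le = z≤n
sumTo-mono (suc n) le = +-mono-≤ (le 0) (sumTo-mono n (λ i → le (suc i)))

sumTo-+ : ∀ n (f g : ℕ → ℕ) → sumTo n (λ i → f i + g i) ≡ sumTo n f + sumTo n g
sumTo-+ zero    f g = refl
sumTo-+ (suc n) f g = trans (cong (f 0 + g 0 +_) (sumTo-+ n _ _)) (interchange (f 0) (g 0) _ _)
  where
  interchange : ∀ a b c d → a + b + (c + d) ≡ a + c + (b + d)
  interchange = solve-∀

sum-≤ : ∀ {m xs} → All (_≤ m) xs → sum xs ≤ length xs * m
sum-≤ []        = z≤n
sum-≤ (le ∷ ps) = +-mono-≤ le (sum-≤ ps)

Periodic : ∀ {C : Set} → ℕ → (ℕ → C) → Set
Periodic n f = ∀ i → f (i + n) ≡ f i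

-- A shift by one drops `f 0` and appends `f n`, which is the same number by periodicity.
sumTo-shift : ∀ {n f} → Periodic n f → ∀ o → sumTo n (λ i → f (o + i)) ≡ sumTo n f
sumTo-shift         periodic zero    = refl
sumTo-shift {n} {f} periodic (suc o) =
  trans (sumTo-shift {f = λ i → f (suc i)} (λ i → periodic (suc i)) o) (+-cancelˡ-≡ (f 0) _ _ (begin
    f 0 + sumTo n (λ i → f (suc i))       ≡⟨ cong sum (applyUpTo-∷ʳ f n) ⟨
    sum (applyUpTo f n ++ f n ∷ [])       ≡⟨ sum-∷ʳ (applyUpTo f n) (f n) ⟩
    sumTo n f + f n                       ≡⟨ cong (sumTo n f +_) (periodic 0) ⟩
    sumTo n f + f 0                       ≡⟨ +-comm (sumTo n f) (f 0) ⟩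
    f 0 + sumTo n f                       ∎))
  where
  open ≡-Reasoning
  sum-∷ʳ : ∀ xs x → sum (xs ++ x ∷ []) ≡ sum xs + x
  sum-∷ʳ []       x = +-identityʳ x
  sum-∷ʳ (y ∷ xs) x = trans (cong (y +_) (sum-∷ʳ xs x)) (sym (+-assoc y _ x))

sumTo-shift′ : ∀ {n f} → Periodic n f → ∀ o → sumTo n (λ i → f (i + o)) ≡ sumTo n f
sumTo-shift′ {n} {f} periodic o =
  trans (cong sum (applyUpTo-cong (λ i → cong f (+-comm i o)) n)) (sumTo-shift periodic o)

-- Recursion on `k` fits the types, since `suc k * d` unfolds to `d + k * d`. With a family indexed
-- by ℕ, dropping its first member or rotating it only reindexes.
embed : ∀ {d} k → (ℕ → 𝒫 d) → 𝒫 (k * d)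
embed zero    f = [] , ((λ ()) , [])
embed (suc k) f = join𝒫 (f 0) (embed k (λ i → f (suc i)))

𝒰-embed-≤ : ∀ {d} k (f g : ℕ → 𝒫 d) → 𝒰 (embed k f) (embed k g) ≤ sumTo k (λ i → 𝒰 (f i) (g i))
𝒰-embed-≤ zero    f g = z≤n
𝒰-embed-≤ (suc k) f g = ≤-trans (𝒰-join-≤ (f 0) (g 0) (embed k (λ i → f (suc i))) (embed k (λ i → g (suc i)))) (+-monoʳ-≤ (𝒰 (f 0) (g 0)) (𝒰-embed-≤ k (λ i → f (suc i)) (λ i → g (suc i))))

if0-∸ : ∀ m n → if0 (m ∸ n) m n ≤ m × if0 (m ∸ n) m n ≤ n
if0-∸ m n with m ∸ n in eq
... | zero  = ≤-refl , m∸n≡0⇒m≤n eq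
... | suc _ = <⇒≤ (m<n+o⇒m∸n≡suc eq) , ≤-refl
  where
  m<n+o⇒m∸n≡suc : ∀ {o} → m ∸ n ≡ suc o → suc n ≤ m
  m<n+o⇒m∸n≡suc eq = ≰⇒> λ m≤n → contradiction (trans (sym eq) (m≤n⇒m∸n≡0 m≤n)) λ ()

if0-natural : ∀ {C D : Set} (h : C → D) l {x y} → h (if0 l x y) ≡ if0 l (h x) (h y)
if0-natural h zero    = refl
if0-natural h (suc _) = refl

argmin-≤ˡ : ∀ {C : Set} (f : C → ℕ) x y → f (argmin f x y) ≤ f x
argmin-≤ˡ f x y = subst (_≤ f x) (sym (if0-natural f (f x ∸ f y))) (proj₁ (if0-∸ (f x) (f y)))

argmin-≤ʳ : ∀ {C : Set} (f : C → ℕ) x y → f (argmin f x y) ≤ f y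
argmin-≤ʳ f x y = subst (_≤ f y) (sym (if0-natural f (f x ∸ f y))) (proj₂ (if0-∸ (f x) (f y)))

-- `ρ` carries the cheapest candidate so far, so that the recursion runs in step with the loop of
-- `recoverℕ`.
bestBlock : ∀ {d} → (𝒫 d → ℕ) → ∀ k → 𝒫 (k * d) → 𝒫 d → 𝒫 d
bestBlock     c zero    τ ρ = ρ
bestBlock {d} c (suc k) τ ρ = bestBlock c k (high𝒫 d τ) (argmin c ρ (low𝒫 d τ))

bestBlock-≤ : ∀ {d} (c : 𝒫 d → ℕ) k τ ρ → c (bestBlock c k τ ρ) ≤ c ρ
bestBlock-≤     c zero    τ ρ = ≤-refl
bestBlock-≤ {d} c (suc k) τ ρ = ≤-trans (bestBlock-≤ c k _ _) (argmin-≤ˡ c ρ (low𝒫 d τ))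

-- Every column of the array σ takes the same values, hence every block of
-- τ contributes its full cost to the sum on the right.
bestBlock-average : ∀ {d} (c : 𝒫 d → ℕ) l k (σ : ℕ → ℕ → 𝒫 d) →
  (∀ ρ i → sumTo l (λ j → 𝒰 ρ (σ j i)) ≡ c ρ) →
  ∀ τ ρ → k * c (bestBlock c k τ ρ) ≤ sumTo l (λ j → 𝒰 τ (embed k (σ j)))
bestBlock-average     c l zero    σ column τ ρ = z≤n
bestBlock-average {d} c l (suc k) σ column τ ρ = begin
  c best + k * c best
    -- By definition `best` is also the result of the recursion on the remaining blocks, so the
    -- induction hypothesis speaks of the very same cost.
    ≤⟨ +-mono-≤ (≤-trans (bestBlock-≤ c k _ _) (argmin-≤ʳ c ρ (low𝒫 d τ)))
         (bestBlock-average c l k (λ j i → σ j (suc i)) (λ ρ i → column ρ (suc i)) (high𝒫 d τ) (argmin c ρ (low𝒫 d τ))) ⟩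
  c (low𝒫 d τ) + sumTo l (λ j → 𝒰 (high𝒫 d τ) (embed k (λ i → σ j (suc i))))
    ≡⟨ cong (_+ sumTo l (λ j → 𝒰 (high𝒫 d τ) (embed k (λ i → σ j (suc i))))) (column (low𝒫 d τ) 0) ⟨
  sumTo l (λ j → 𝒰 (low𝒫 d τ) (σ j 0)) + sumTo l (λ j → 𝒰 (high𝒫 d τ) (embed k (λ i → σ j (suc i))))
    ≡⟨ sumTo-+ l _ _ ⟨
  sumTo l (λ j → 𝒰 (low𝒫 d τ) (σ j 0) + 𝒰 (high𝒫 d τ) (embed k (λ i → σ j (suc i))))
    ≤⟨ sumTo-mono l (λ j → 𝒰-join-≥ τ (σ j 0) (embed k (λ i → σ j (suc i)))) ⟩
  sumTo l (λ j → 𝒰 τ (embed (suc k) (σ j))) ∎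
  where
  open ≤-Reasoning
  best = bestBlock c (suc k) τ ρ

-- The reduction from median to center

cyclic : (Π : Instance) → ℕ → 𝒫 (d Π)
cyclic (inst k d perm) n = perm (n mod k)

cyclic-periodic : ∀ Π → Periodic (k Π) (cyclic Π)
cyclic-periodic (inst k d perm) i = cong perm (toℕ-injective (begin
  toℕ ((i + k) mod k)      ≡⟨ toℕ-fromℕ< _ ⟩
  (i + k) % k              ≡⟨ [m+n]%n≡m%n i k ⟩
  i % k                    ≡⟨ toℕ-fromℕ< _ ⟨
  toℕ (i mod k)            ∎))
  where open ≡-Reasoning

cyclic-toℕ : ∀ Π j → cyclic Π (toℕ j) ≡ perm Π j
cyclic-toℕ (inst k d perm) j = cong perm (toℕ-injective (trans (toℕ-fromℕ< _) (m<n⇒m%n≡m (toℕ<n j))))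

center : Instance → Instance
center Π@(inst k d perm) = inst k (k * d) (λ j → embed k (λ i → cyclic Π (toℕ j + i)))

-- π_0 is the initial candidate: an extra candidate can only lower the final cost, and the program
-- has this one at hand as the first word.
recover : (Π : Instance) → 𝒫 (d (center Π)) → 𝒫 (d Π)
recover Π τ = bestBlock (cost Π) (k Π) τ (cyclic Π 0)

cost-sumTo : ∀ Π ρ → cost Π ρ ≡ sumTo (k Π) (λ j → 𝒰 ρ (cyclic Π j))
cost-sumTo Π ρ = cong sum (trans
  (tabulate-cong (λ j → cong (𝒰 ρ) (sym (cyclic-toℕ Π j))))
  (tabulate-toℕ (λ j → 𝒰 ρ (cyclic Π j)) (k Π)))

rad-embed : ∀ Π ρ → rad (center Π) (embed (k Π) (λ _ → ρ)) ≤ cost Π ρ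
rad-embed Π ρ = max≤v⁺ z≤n (All.tabulate⁺ {n = k Π} λ j → begin
  𝒰 (embed (k Π) (λ _ → ρ)) (embed (k Π) (λ i → cyclic Π (toℕ j + i)))
    ≤⟨ 𝒰-embed-≤ (k Π) (λ _ → ρ) (λ i → cyclic Π (toℕ j + i)) ⟩
  sumTo (k Π) (λ i → 𝒰 ρ (cyclic Π (toℕ j + i)))
    ≡⟨ sumTo-shift (λ i → cong (𝒰 ρ) (cyclic-periodic Π i)) (toℕ j) ⟩
  sumTo (k Π) (λ i → 𝒰 ρ (cyclic Π i))
    ≡⟨ cost-sumTo Π ρ ⟨
  cost Π ρ ∎)
  where open ≤-Reasoning

cost-recover : ∀ Π τ → cost Π (recover Π τ) ≤ rad (center Π) τ
-- The factor k can be cancelled because the family is nonempty.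
cost-recover Π@(inst k d perm) τ = *-cancelˡ-≤ k (begin
  k * cost Π (recover Π τ)
    ≤⟨ bestBlock-average (cost Π) k k (λ j i → cyclic Π (j + i))
         -- For fixed i the index j + i runs through one full period, so column i holds the whole
         -- family and the distances to it add up to the cost.
         (λ ρ i → trans (sumTo-shift′ (λ j → cong (𝒰 ρ) (cyclic-periodic Π j)) i) (sym (cost-sumTo Π ρ)))
         τ (cyclic Π 0) ⟩
  sumTo k (λ j → 𝒰 τ (embed k (λ i → cyclic Π (j + i))))
    ≡⟨ cong sum (tabulate-toℕ (λ j → 𝒰 τ (embed k (λ i → cyclic Π (j + i)))) k) ⟨
  sum distances
    ≤⟨ sum-≤ (xs≤max 0 distances) ⟩
  length distances * rad (center Π) τ
    ≡⟨ cong (_* rad (center Π) τ) (length-tabulate {n = k} (λ j → 𝒰 τ (embed k (λ i → cyclic Π (toℕ j + i))))) ⟩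
  k * rad (center Π) τ ∎)
  where
  open ≤-Reasoning
  distances = tabulate {n = k} (λ j → 𝒰 τ (embed k (λ i → cyclic Π (toℕ j + i))))

OPT-center : ∀ Π → OPT-ctr (center Π) ≡ OPT-med Π
OPT-center Π with OPT-med-isMinimum Π | OPT-ctr-isMinimum (center Π)
... | (ρ , ρ-opt) , med-least | (τ , τ-opt) , ctr-least = ≤-antisym
  (≤-trans (ctr-least (embed (k Π) (λ _ → ρ))) (≤-trans (rad-embed Π ρ) (≤-reflexive ρ-opt)))
  (≤-trans (med-least (recover Π τ)) (≤-trans (cost-recover Π τ) (≤-reflexive τ-opt)))

-- The list programs compute the reduction

codes : List (Fin n) → List ℕ
codes = map toℕ

if≡-refl : ∀ {C : Set} n {x y : C} → if≡ n n x y ≡ x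
if≡-refl n rewrite n∸n≡0 n = refl

if≡-≢ : ∀ {C : Set} {m n} {x y : C} → m ≢ n → if≡ m n x y ≡ y
if≡-≢ {m = m} {n} m≢n with m ∸ n in p | n ∸ m in q
... | suc _ | _     = refl
... | zero  | suc _ = refl
... | zero  | zero  = contradiction (≤-antisym (m∸n≡0⇒m≤n p) (m∸n≡0⇒m≤n q)) m≢n

-- `lcs` decides equality of the heads and otherwise keeps the longer of two candidates. Injectivity
-- of `toℕ` turns the decision into a test on codes, and the longer length is the maximum.
LCS-∷ : ∀ (a b : Fin n) x y →
  LCS (a ∷ x) (b ∷ y) ≡ if≡ (toℕ a) (toℕ b) (suc (LCS x y)) (LCS x (b ∷ y) ⊔ LCS (a ∷ x) y)
LCS-∷ a b x y with a Fin.≟ b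
... | yes refl = sym (if≡-refl (toℕ a))
... | no a≢b with ≤-total (LCS x (b ∷ y)) (LCS (a ∷ x) y)
...   | inj₁ le = trans (sym (m≤n⇒m⊔n≡n le)) (sym (if≡-≢ (a≢b ∘ toℕ-injective)))
...   | inj₂ le = trans (sym (m≥n⇒m⊔n≡m le)) (sym (if≡-≢ (a≢b ∘ toℕ-injective)))

LCS-[] : (x : List (Fin n)) → LCS x [] ≡ 0
LCS-[] []      = refl
LCS-[] (_ ∷ _) = refl

-- The intended contents of a row, against which the dynamic program is verified.
rowOf : List (Fin n) → List (Fin n) → ⟦ Row ⟧
rowOf x []      = []
rowOf x (b ∷ y) = (toℕ b , (LCS x (b ∷ y) , LCS x y)) ∷ rowOf x y

corner-rowOf : (x y : List (Fin n)) → corner (rowOf x y) ≡ LCS x y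
corner-rowOf x []      = sym (LCS-[] x)
corner-rowOf x (b ∷ y) = refl

nextRow-rowOf : ∀ (a : Fin n) x y → nextRow (toℕ a) (rowOf x y) ≡ rowOf (a ∷ x) y
nextRow-rowOf a x []      = refl
nextRow-rowOf a x (b ∷ y) rewrite nextRow-rowOf a x y | corner-rowOf (a ∷ x) y =
  cong (λ l → (toℕ b , (l , LCS (a ∷ x) y)) ∷ rowOf (a ∷ x) y) (sym (LCS-∷ a b x y))

lcsRow-codes : (x y : List (Fin n)) → lcsRow (codes x) (codes y) ≡ rowOf x y
lcsRow-codes []      []      = refl
lcsRow-codes []      (b ∷ y) = cong (_ ∷_) (lcsRow-codes [] y)
lcsRow-codes (a ∷ x) y       = trans (cong (nextRow (toℕ a)) (lcsRow-codes x y)) (nextRow-rowOf a x y)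

lcsℕ-codes : (x y : List (Fin n)) → lcsℕ (codes x) (codes y) ≡ LCS x y
lcsℕ-codes x y = trans (cong corner (lcsRow-codes x y)) (corner-rowOf x y)

lowℕ-codes : ∀ m (w : List (Fin (m + n))) → lowℕ m (codes w) ≡ codes (low m w)
lowℕ-codes m []      = refl
lowℕ-codes {n} m (a ∷ w) with splitAt m a in split
... | inj₁ i rewrite sym (splitAt⁻¹-↑ˡ split) | toℕ-↑ˡ i n | m≤n⇒m∸n≡0 (toℕ<n i) =
  cong (toℕ i ∷_) (lowℕ-codes m w)
... | inj₂ i rewrite sym (splitAt⁻¹-↑ʳ split) | toℕ-↑ʳ m i | sym (+-suc m (toℕ i)) | m+n∸m≡n m (suc (toℕ i)) =
  lowℕ-codes m w

highℕ-codes : ∀ m (w : List (Fin (m + n))) → highℕ m (codes w) ≡ codes (high m w)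
highℕ-codes m []      = refl
highℕ-codes {n} m (a ∷ w) with splitAt m a in split
... | inj₁ i rewrite sym (splitAt⁻¹-↑ˡ split) | toℕ-↑ˡ i n | m≤n⇒m∸n≡0 (toℕ<n i) =
  highℕ-codes m w
... | inj₂ i rewrite sym (splitAt⁻¹-↑ʳ split) | toℕ-↑ʳ m i | m+n∸m≡n m (toℕ i)
                   | sym (+-suc m (toℕ i)) | m+n∸m≡n m (suc (toℕ i)) =
  cong (toℕ i ∷_) (highℕ-codes m w)

code : 𝒫 n → List ℕ
code σ = codes (word σ)

length-code : (σ : 𝒫 n) → length (code σ) ≡ n
length-code σ = trans (length-map toℕ (word σ)) (length-word σ)

embedℕ-code : ∀ {d} k (f : ℕ → 𝒫 d) → embedℕ (applyUpTo (λ i → code (f i)) k) ≡ code (embed k f)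
embedℕ-code         zero    f = refl
embedℕ-code {d} (suc k) f = begin
  code (f 0) ++ map (length (code (f 0)) +_) (embedℕ (applyUpTo (λ i → code (f (suc i))) k))
    ≡⟨ cong₂ (λ l w → code (f 0) ++ map (l +_) w) (length-code (f 0)) (embedℕ-code k (λ i → f (suc i))) ⟩
  code (f 0) ++ map (d +_) (codes rest)
    ≡⟨ cong₂ _++_ (map-cong (λ i → toℕ-↑ˡ i (k * d)) (word (f 0))) (trans (map-cong (toℕ-↑ʳ d) rest) (map-∘ rest)) ⟨
  map (λ i → toℕ (i ↑ˡ (k * d))) (word (f 0)) ++ map (λ i → toℕ (d ↑ʳ i)) rest
    ≡⟨ cong₂ _++_ (map-∘ (word (f 0))) (map-∘ rest) ⟩
  codes (map (_↑ˡ (k * d)) (word (f 0))) ++ codes (map (d ↑ʳ_) rest)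
    ≡⟨ map-++ toℕ (map (_↑ˡ (k * d)) (word (f 0))) (map (d ↑ʳ_) rest) ⟨
  code (embed (suc k) f) ∎
  where
  open ≡-Reasoning
  rest = word (embed k (λ i → f (suc i)))

instanceCode : Instance → List (List ℕ)
instanceCode Π = tabulate (λ j → code (perm Π j))

instanceCode-cyclic : ∀ Π → instanceCode Π ≡ applyUpTo (λ i → code (cyclic Π i)) (k Π)
instanceCode-cyclic Π = trans
  (tabulate-cong (λ j → cong code (sym (cyclic-toℕ Π j))))
  (tabulate-toℕ (λ i → code (cyclic Π i)) (k Π))

enc-instanceCode : ∀ Π → enc (list (list nat)) (instanceCode Π) ≡ ⌜ Π ⌝I
enc-instanceCode Π = cong ⌜_⌝L (trans (map-tabulate (λ j → code (perm Π j)) (enc (list nat)))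
  (tabulate-cong (λ j → cong ⌜_⌝L (sym (map-∘ (word (perm Π j)))))))

enc-code : (σ : 𝒫 n) → enc (list nat) (code σ) ≡ ⌜ σ ⌝𝒫
enc-code σ = cong ⌜_⌝L (sym (map-∘ (word σ)))

-- The entry moved to the end is `f 0`, equal to `f n` by periodicity.
rotate-applyUpTo : ∀ {C : Set} {f : ℕ → C} n → Periodic n f → rotate (applyUpTo f n) ≡ applyUpTo (λ i → f (suc i)) n
rotate-applyUpTo         zero    periodic = refl
rotate-applyUpTo {f = f} (suc n) periodic =
  trans (cong (λ x → applyUpTo (λ i → f (suc i)) n ++ x ∷ []) (sym (periodic 0))) (applyUpTo-∷ʳ (λ i → f (suc i)) n)

-- Each round continues with the shifted function, which is again periodic, so the induction is over
-- all periodic `f`. The outputs pile up in reverse, hence `_ʳ++_`.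
rotations : ∀ {k} f → Periodic k f → ∀ (xs ws : List (List ℕ)) →
  proj₂ (foldl (λ s _ → rotationStep s) (applyUpTo f k , ws) xs)
  ≡ applyUpTo (λ j → embedℕ (applyUpTo (λ i → f (j + i)) k)) (length xs) ʳ++ ws
rotations         f periodic []       ws = refl
rotations {k} f periodic (_ ∷ xs) ws rewrite rotate-applyUpTo k periodic =
  rotations (λ i → f (suc i)) (λ i → periodic (suc i)) xs (embedℕ (applyUpTo f k) ∷ ws)

centerℕ-code : ∀ Π → centerℕ (instanceCode Π) ≡ instanceCode (center Π)
centerℕ-code Π@(inst k d perm) = begin
  centerℕ (instanceCode Π)
    ≡⟨ cong centerℕ (instanceCode-cyclic Π) ⟩
  centerℕ (applyUpTo row k)
    ≡⟨ cong reverse (rotations row (λ i → cong code (cyclic-periodic Π i)) (applyUpTo row k) []) ⟩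
  reverse (reverse (applyUpTo (λ j → embedℕ (applyUpTo (λ i → row (j + i)) k)) (length (applyUpTo row k))))
    ≡⟨ reverse-involutive _ ⟩
  applyUpTo (λ j → embedℕ (applyUpTo (λ i → row (j + i)) k)) (length (applyUpTo row k))
    ≡⟨ cong (applyUpTo _) (length-applyUpTo row k) ⟩
  applyUpTo (λ j → embedℕ (applyUpTo (λ i → row (j + i)) k)) k
    ≡⟨ applyUpTo-cong (λ j → embedℕ-code k (λ i → cyclic Π (j + i))) k ⟩
  applyUpTo (λ j → code (embed k (λ i → cyclic Π (j + i)))) k
    ≡⟨ tabulate-toℕ (λ j → code (embed k (λ i → cyclic Π (j + i)))) k ⟨
  instanceCode (center Π) ∎
  where
  open ≡-Reasoning
  row = λ i → code (cyclic Π i)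

sumMap-tabulate : ∀ {C : Set} (f : C → ℕ) {n} (g : Fin n → C) → sumMap f (tabulate g) ≡ sum (tabulate (λ i → f (g i)))
sumMap-tabulate f {zero}  g = refl
sumMap-tabulate f {suc n} g = cong (f (g Fin.zero) +_) (sumMap-tabulate f (λ i → g (Fin.suc i)))

costℕ-code : ∀ Π ρ → costℕ (instanceCode Π) (code ρ) ≡ cost Π ρ
costℕ-code Π ρ = trans
  (sumMap-tabulate (λ w → length (code ρ) ∸ lcsℕ (code ρ) w) (λ j → code (perm Π j)))
  (cong sum (tabulate-cong (λ j → cong₂ _∸_ (length-code ρ) (lcsℕ-codes (word ρ) (word (perm Π j))))))

firstWord-code : ∀ Π → firstWord (instanceCode Π) ≡ code (cyclic Π 0)
firstWord-code Π = trans (cong firstWord (instanceCode-cyclic Π)) (nonEmpty Π)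
  where
  nonEmpty : ∀ Π → firstWord (applyUpTo (λ i → code (cyclic Π i)) (k Π)) ≡ code (cyclic Π 0)
  -- `NonZero k` excludes the empty family, for which `firstWord` would return its default value.
  nonEmpty (inst (suc k) d perm) = refl

-- Here `n` is the number of symbols in the blocks still to come; it is arbitrary so that the step
-- can be used throughout the loop.
recoverStep-code : ∀ Π {n} (τ : 𝒫 (d Π + n)) ρ →
  recoverStep (instanceCode Π) (code τ , code ρ)
  ≡ (code (high𝒫 (d Π) τ) , code (argmin (cost Π) ρ (low𝒫 (d Π) τ)))
recoverStep-code Π τ ρ rewrite firstWord-code Π | length-code (cyclic Π 0)
  | highℕ-codes (d Π) (word τ) | lowℕ-codes (d Π) (word τ)
  | costℕ-code Π ρ | costℕ-code Π (low𝒫 (d Π) τ) =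
  -- Choosing between two codes is the same as taking the code of the chosen permutation.
  cong (code (high𝒫 (d Π) τ) ,_) (sym (if0-natural code (cost Π ρ ∸ cost Π (low𝒫 (d Π) τ))))

recoverℕ-code : ∀ Π τ → recoverℕ (instanceCode Π , code τ) ≡ code (recover Π τ)
recoverℕ-code Π τ = trans
  (cong₂ (λ w xs → proj₂ (foldl step (code τ , w) xs)) (firstWord-code Π) (instanceCode-cyclic Π))
  (steps (k Π) (λ i → code (cyclic Π i)) τ (cyclic Π 0))
  where
  step : List ℕ × List ℕ → List ℕ → List ℕ × List ℕ
  step s _ = recoverStep (instanceCode Π) s
  steps : ∀ l (f : ℕ → List ℕ) τ ρ →
          proj₂ (foldl step (code τ , code ρ) (applyUpTo f l)) ≡ code (bestBlock (cost Π) l τ ρ)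
  steps zero    f τ ρ = refl
  steps (suc l) f τ ρ = trans
    (cong (λ s → proj₂ (foldl step s (applyUpTo (λ i → f (suc i)) l))) (recoverStep-code Π τ ρ))
    (steps l (λ i → f (suc i)) _ _)

-- The program is used unchanged, because the codes have the same trees as the objects they
-- represent. Trees have positive size, so the monomial bound on the running time applies to every
-- input.
comp-polyTime : ∀ {Γ A f} {S : Set} {T : S → Set} {encS : S → Tree} {encT : ∀ {s} → T s → Tree}
  {F : (s : S) → T s} (code : S → ⟦ Γ ⟧) → Comp Γ A f → (∀ s → enc Γ (code s) ≡ encS s) →
  (∀ s → enc A (f (code s)) ≡ encT (F s)) → PolyTime encS encT F
comp-polyTime {Γ} {f = f} {encS = encS} {encT} {F} code c eqΓ eqA with eval-bounded (time c)
... | a , e , bound = prog c , a , e , λ s → run s (runs c (code s))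
  where
  run : ∀ s → prog c ⊢ enc Γ (code s) ⇓ enc _ (f (code s)) within eval (time c) (sz Γ (code s)) →
        ∃[ n ] (prog c ⊢ encS s ⇓ encT (F s) ∣ n) × n ≤ a * size (encS s) ^ e + a
  run s (n , r , le) rewrite eqΓ s | eqA s = n , r ,
    ≤-trans le (≤-trans (positive (size (encS s)) (size≥1 (encS s))) (m≤m+n _ a))
    where
    positive : ∀ m → 1 ≤ m → eval (time c) m ≤ a * m ^ e
    positive (suc m) _ = bound m

lemma6p1 : Σ[ 𝒞 ∈ (Instance → Instance) ]
    PolyTime ⌜_⌝I ⌜_⌝I 𝒞
    × (∀ Π → k (𝒞 Π) ≡ k Π × d (𝒞 Π) ≡ k Π * d Π × OPT-ctr (𝒞 Π) ≡ OPT-med Π)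
    × (Σ[ recover ∈ ((Π : Instance) → 𝒫 (d (𝒞 Π)) → 𝒫 (d Π)) ]
    PolyTime (⌜_⌝I×𝒫 {𝒞}) ⌜_⌝𝒫 (uncurry recover)
    × (∀ Π (τ : 𝒫 (d (𝒞 Π))) (R : ℕ) → rad (𝒞 Π) τ ≤ R → cost Π (recover Π τ) ≤ R))
lemma6p1 =
    center
  , comp-polyTime {encT = ⌜_⌝I} {center} instanceCode comp-centerℕ enc-instanceCode
      (λ Π → trans (cong (enc (list (list nat))) (centerℕ-code Π)) (enc-instanceCode (center Π)))
  , (λ Π → refl , refl , OPT-center Π)
  , recover
  , comp-polyTime {encT = ⌜_⌝𝒫} {uncurry recover} (λ { (Π , τ) → instanceCode Π , code τ }) comp-recoverℕ
      (λ { (Π , τ) → cong₂ _∙_ (enc-instanceCode Π) (enc-code τ) })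
      (λ { (Π , τ) → trans (cong (enc (list nat)) (recoverℕ-code Π τ)) (enc-code (recover Π τ)) })
  , λ Π τ R rad≤R → ≤-trans (cost-recover Π τ) rad≤R
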